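{- Let \[ f(\alpha;q)=\sum_{n=0}^\infty \frac{q^{n^2-n}\alpha^n}{(-q;q)_n(-\alpha;q)_n},\quad \phi(\alpha;q)=\sum_{n=0}^\infty \frac{q^{n^2}}{(-\alpha q;q^2)_n},\quad \psi(\alpha;q)=\sum_{n=1}^\infty \frac{q^{n^2}}{(\alpha;q^2)_n}. \] Then \begin{align*} f(\alpha q;q)&=1+\sum_{\lambda \in P} (-1)^{r(\lambda)}\alpha^{\lambda_1}q^{|\lambda|},\\ \phi(-\alpha q;-q)&=1+\sum_{\lambda \in DO}(-1)^{\frac{\lambda_1+1}{2}}\alpha^{\frac{\lambda_1+1}{2}-l(\lambda)}q^{|\lambda|},\\ \psi(-\alpha q;-q)&=\sum_{\lambda \in OC}(-1)^{l(\lambda)} \alpha^{l(\lambda)-\frac{\lambda_1+1}{2}}q^{|\lambda|}. \end{align*}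
   Context: Notation: $(a;q)_n=(1-a)(1-aq)\cdots(1-aq^{n-1})$, $(a;q)_0=1$; identities are of formal power series in $q$ with coefficients polynomial in $\alpha$. For a partition $\lambda=(\lambda_1\ge\lambda_2\ge\cdots)$, $\lambda_1$ is its largest part, $|\lambda|$ its sum, $l(\lambda)$ its number of parts, and $r(\lambda)=\lambda_1-l(\lambda)$ its (Dyson) rank. $P$ is the set of nonempty partitions; $DO$ is the set of nonempty partitions into distinct odd parts; $OC$ is the set of nonempty partitions into odd parts without gaps, i.e. all parts are odd and every odd number from $1$ up to the largest part occurs as a part. -}

module Defs where

open import Data.Nat as ℕ using (ℕ; zero; suc; _∸_; _≤_; _<_; _>_; _≥_; _%_; _/_)
open import Data.Nat.Properties as ℕP using (_≤?_; _<?_; _≥?_; _>?_)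
open import Data.Integer as ℤ using (ℤ; +_; -_; ∣_∣)
open import Data.Integer.Properties as ℤP using ()
open import Data.List using (List; []; _∷_; length; upTo; map; foldr; concat; concatMap; filter)
open import Data.Nat.ListAction using (sum)
open import Data.List.Relation.Unary.All using (All; all?)
open import Data.List.Relation.Unary.Linked using (Linked; linked?)
open import Data.List.Membership.Propositional using (_∈_)
open import Data.List.Membership.DecPropositional ℕ._≟_ using (_∈?_)
open import Data.Product using (_×_)
open import Data.Unit using (⊤; tt)
open import Data.Empty using (⊥)
open import Relation.Binary.PropositionalEquality using (_≡_)
open import Relation.Nullary using (Dec; yes; no; does)
open import Relation.Nullary.Decidable using (_×-dec_; _→-dec_)
open import Data.Bool using (Bool; true; false; if_then_else_; _∧_)

-- Formal power series in two variables q and α with integer coefficients.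
-- A series F is its coefficient function: F N k = coefficient of q^N α^k.
-- (ℤ[α][[q]] embeds into ℤ[[α,q]], so identities may be checked here.)

Ser : Set
Ser = ℕ → ℕ → ℤ

Σ≤ : ℕ → (ℕ → ℤ) → ℤ
Σ≤ n f = foldr ℤ._+_ (+ 0) (map f (upTo (suc n)))

0s 1s qS αS : Ser
0s N k = + 0
1s zero zero = + 1
1s _    _    = + 0
qS (suc zero) zero = + 1
qS _          _    = + 0
αS zero (suc zero) = + 1
αS _    _          = + 0

infixl 6 _+s_ _-s_
infixl 7 _*s_
infixr 8 _^s_

_+s_ _-s_ _*s_ : Ser → Ser → Ser
(F +s G) N k = F N k ℤ.+ G N k
(F -s G) N k = F N k ℤ.- G N k
(F *s G) N k = Σ≤ N (λ i → Σ≤ k (λ j → F i j ℤ.* G (N ∸ i) (k ∸ j)))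

-s_ : Ser → Ser
(-s F) N k = ℤ.- F N k

_^s_ : Ser → ℕ → Ser
F ^s zero  = 1s
F ^s suc n = F *s (F ^s n)

-- Infinite sum Σ_{n≥0} T n of a family whose n-th term has total
-- (q,α)-degree ≥ n: the coefficient of q^N α^k only receives contributions
-- from n ≤ N + k.  (Every use below satisfies this order condition.)
Σ∞ : (ℕ → Ser) → Ser
Σ∞ T N k = Σ≤ (N ℕ.+ k) (λ n → T n N k)

-- Multiplicative inverse of a series with constant term 1:
-- 1/F = Σ_{m≥0} (1 - F)^m  (the m-th term has order ≥ m).
inv : Ser → Ser
inv F = Σ∞ (λ m → (1s -s F) ^s m)

poch : Ser → Ser → ℕ → Ser
poch a b zero    = 1s
poch a b (suc n) = poch a b n *s (1s -s a *s b ^s n)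

fS : Ser → Ser → Ser
fS a q = Σ∞ (λ n → q ^s (n ℕ.* n ∸ n) *s a ^s n *s inv (poch (-s q) q n *s poch (-s a) q n))

φS : Ser → Ser → Ser
φS a q = Σ∞ (λ n → q ^s (n ℕ.* n) *s inv (poch (-s (a *s q)) (q *s q) n))

ψS : Ser → Ser → Ser
ψS a q = Σ∞ (λ m → q ^s (suc m ℕ.* suc m) *s inv (poch a (q *s q) (suc m)))

-- Partitions, written as lists of parts in weakly decreasing order λ₁ ≥ λ₂ ≥ …

largest : List ℕ → ℕ
largest []      = 0
largest (x ∷ _) = x

NonEmpty : List ℕ → Set
NonEmpty []      = ⊥
NonEmpty (_ ∷ _) = ⊤

nonEmpty? : (l : List ℕ) → Dec (NonEmpty l)
nonEmpty? []      = no (λ ())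
nonEmpty? (_ ∷ _) = yes tt

Odd : ℕ → Set
Odd n = n % 2 ≡ 1

odd? : (n : ℕ) → Dec (Odd n)
odd? n = (n % 2) ℕ.≟ 1

InP : List ℕ → Set
InP l = NonEmpty l × All (1 ≤_) l × Linked _≥_ l

InDO : List ℕ → Set
InDO l = InP l × Linked _>_ l × All Odd l

InOC : List ℕ → Set
InOC l = InP l × All Odd l × All (λ m → Odd m → m ∈ l) (upTo (suc (largest l)))

inP? : (l : List ℕ) → Dec (InP l)
inP? l = nonEmpty? l ×-dec (all? (1 ≤?_) l ×-dec linked? _≥?_ l)

inDO? : (l : List ℕ) → Dec (InDO l)
inDO? l = inP? l ×-dec (linked? _>?_ l ×-dec all? odd? l)

inOC? : (l : List ℕ) → Dec (InOC l)
inOC? l = inP? l ×-dec (all? odd? l ×-dec all? (λ m → odd? m →-dec (m ∈? l)) (upTo (suc (largest l))))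

lists : ℕ → ℕ → List (List ℕ)
lists zero    b = [] ∷ []
lists (suc n) b = concatMap (λ x → map (x ∷_) (lists n b)) (map suc (upTo b))

-- candidates N: all lists of length ≤ N with entries in 1 .. N
-- (contains every partition of N exactly once)
candidates : ℕ → List (List ℕ)
candidates N = concatMap (λ len → lists len N) (upTo (suc N))

genSer : {S : List ℕ → Set} → ((l : List ℕ) → Dec (S l)) →
         (List ℕ → ℤ) → (List ℕ → ℤ) → Ser
genSer S? sg ex N k =
  foldr ℤ._+_ (+ 0)
    (map (λ l → if does (S? l) ∧ does (sum l ℕ.≟ N) ∧ does (ex l ℤ.≟ + k)
                then sg l else + 0)
         (candidates N))

sgnℕ : ℕ → ℤ
sgnℕ n = (ℤ.- + 1) ℤ.^ n

sgn : ℤ → ℤ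
sgn r = sgnℕ ∣ r ∣

rank : List ℕ → ℤ
rank l = + largest l ℤ.- + length l

half : List ℕ → ℕ
half l = (largest l ℕ.+ 1) / 2

_≈s_ : Ser → Ser → Set
F ≈s G = ∀ N k → F N k ≡ G N k
infix 4 _≈s_

module Submission where

-- Each term of the three q-series is the generating function of a class of partitions.
-- For φ the class is fixed by the number of parts, for ψ by the largest part; both families satisfy a first-order
-- recurrence in the class index, which is multiplication by one factor of the q-Pochhammer symbol.
-- For f the partitions with largest part m contribute (-1)^(m-1) (αq)^m / (-q;q)_m. With G_n = 1/(-q;q)_n and
-- H_n = 1/(-αq;q)_n put b r j = q^(j(j+r+1)) α^j H_(j+1) G_(j+r), so that f(αq;q) = 1 + αq Σ_j b 1 j, and let
-- u r j be b r j with H_j in place of H_(j+1). Then b r j + αq b (r+1) j = u r j - u r (j+1), and telescoping gives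
-- Σ_j b r j = G_r - αq Σ_j b (r+1) j. Iterating in r yields Σ_j b 1 j = Σ_d (-αq)^d G_(d+1).

-- The n-th term of f(αq;q) counts the partitions whose Durfee square has side n: the square gives
-- α^n q^(n^2), while 1/(-q;q)_n and 1/(-αq;q)_n account for what lies below it and to its right. A
-- list of parts exposes its first part and its length but not its Durfee square, so the
-- rearrangement by largest part is done algebraically. The parameter r is forced, because one
-- telescoping step turns the sum at r into the sum at r + 1. Infinite sums are never manipulated as
-- such: telescoping is a finite identity with a remainder, and the total degree in q and α limits
-- which terms reach a given coefficient, the same bound at which `Σ∞` stops. For φ and ψ the
-- substitution of -q for q leaves the base q^2 alone but turns q^(n^2) into (-q)^(n^2). This is
-- what makes the unsigned counts, weighted by (-1)^(n+k), satisfy the recurrence.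

open import Algebra using (CommutativeRing)
import Algebra.Construct.Pointwise as Pointwise
import Algebra.Properties.Ring as RingProperties
import Algebra.Solver.Ring.NaturalCoefficients.Default as SemiringSolver
open import Data.Nat as ℕ using (ℕ; zero; suc; _∸_; _≤_; _<_; _≥_; _>_; s≤s; z≤n)
import Data.Nat.Properties as ℕ
import Data.Nat.Tactic.RingSolver as ℕSolver
open import Data.Product using (_×_; _,_; proj₁; proj₂; ∃)
open import Function using (_∘_; id; _⇔_; mk⇔)
import Relation.Binary.PropositionalEquality as ≡
import Relation.Binary.Reasoning.Setoid as SetoidReasoning

-- Power series over a commutative ring

module PowerSeries {c ℓ} (R : CommutativeRing c ℓ) where
  open CommutativeRing R
  open SetoidReasoning setoid

  open SemiringSolver commutativeSemiring using (solve; _:+_; _:*_; _:=_)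

  infix  4 _≋_
  infixl 7 _⊛_

  _≋_ : (F G : ℕ → Carrier) → Set ℓ
  F ≋ G = ∀ n → F n ≈ G n

  -- The Cauchy product is defined by recursion on the index instead of as a finite sum, so that
  -- each ring law is an induction with the series generalised. `inner-⊛` and `outer-⊛` recover the
  -- sum.
  _⊕_ _⊛_ : (F G : ℕ → Carrier) → ℕ → Carrier
  (F ⊕ G) n = F n + G n
  (F ⊛ G) zero    = F 0 * G 0
  (F ⊛ G) (suc n) = F 0 * G (suc n) + (F ∘ suc ⊛ G) n

  one : ℕ → Carrier
  one zero    = 1#
  one (suc _) = 0#

  ⊛-cong : ∀ {F F′ G G′} → F ≋ F′ → G ≋ G′ → F ⊛ G ≋ F′ ⊛ G′
  ⊛-cong p r zero    = *-cong (p 0) (r 0)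
  ⊛-cong p r (suc n) = +-cong (*-cong (p 0) (r (suc n))) (⊛-cong (p ∘ suc) r n)

  ⊛-distribʳ : ∀ H F G → (F ⊕ G) ⊛ H ≋ (F ⊛ H) ⊕ (G ⊛ H)
  ⊛-distribʳ H F G zero    = distribʳ _ _ _
  ⊛-distribʳ H F G (suc n) =
    trans (+-cong (distribʳ _ _ _) (⊛-distribʳ H (F ∘ suc) (G ∘ suc) n)) 
      (solve 4 (λ a b c d → (a :+ b) :+ (c :+ d) := (a :+ c) :+ (b :+ d)) refl _ _ _ _)

  ⊛-scaleˡ : ∀ a F G → (λ n → a * F n) ⊛ G ≋ λ n → a * (F ⊛ G) n
  ⊛-scaleˡ a F G zero    = *-assoc _ _ _
  ⊛-scaleˡ a F G (suc n) =
    trans (+-cong (*-assoc _ _ _) (⊛-scaleˡ a (F ∘ suc) G n)) (sym (distribˡ _ _ _))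

  -- The mirror image of the defining recursion, splitting off the head of the second factor;
  -- commutativity follows by comparing the two.
  ⊛-suc : ∀ F G n → (F ⊛ G) (suc n) ≈ F (suc n) * G 0 + (F ⊛ (G ∘ suc)) n
  ⊛-suc F G zero    = +-comm _ _
  ⊛-suc F G (suc n) = begin
    F 0 * G (suc (suc n)) + (F ∘ suc ⊛ G) (suc n)
      ≈⟨ +-congˡ (⊛-suc (F ∘ suc) G n) ⟩
    F 0 * G (suc (suc n)) + (F (suc (suc n)) * G 0 + (F ∘ suc ⊛ (G ∘ suc)) n)
      ≈⟨ solve 3 (λ a b c → a :+ (b :+ c) := b :+ (a :+ c)) refl _ _ _ ⟩
    F (suc (suc n)) * G 0 + (F 0 * G (suc (suc n)) + (F ∘ suc ⊛ (G ∘ suc)) n) ∎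

  ⊛-comm : ∀ F G → F ⊛ G ≋ G ⊛ F
  ⊛-comm F G zero    = *-comm _ _
  ⊛-comm F G (suc n) = trans (+-cong (*-comm _ _) (⊛-comm (F ∘ suc) G n)) (sym (⊛-suc G F n))

  ⊛-assoc : ∀ F G H → (F ⊛ G) ⊛ H ≋ F ⊛ (G ⊛ H)
  ⊛-assoc F G H zero    = *-assoc _ _ _
  ⊛-assoc F G H (suc n) = begin
    (F 0 * G 0) * H (suc n) + (((λ m → F 0 * G (suc m)) ⊕ (F ∘ suc ⊛ G)) ⊛ H) n
      ≈⟨ +-cong (*-assoc _ _ _) (⊛-distribʳ H _ _ n) ⟩
    F 0 * (G 0 * H (suc n)) + (((λ m → F 0 * G (suc m)) ⊛ H) n + ((F ∘ suc ⊛ G) ⊛ H) n)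
      ≈⟨ +-congˡ (+-cong (⊛-scaleˡ (F 0) (G ∘ suc) H n) (⊛-assoc (F ∘ suc) G H n)) ⟩
    F 0 * (G 0 * H (suc n)) + (F 0 * (G ∘ suc ⊛ H) n + (F ∘ suc ⊛ (G ⊛ H)) n)
      ≈⟨ solve 4 (λ a b c d → a :* b :+ (a :* c :+ d) := a :* (b :+ c) :+ d) refl _ _ _ _ ⟩
    F 0 * (G 0 * H (suc n) + (G ∘ suc ⊛ H) n) + (F ∘ suc ⊛ (G ⊛ H)) n ∎

  ⊛-zeroˡ : ∀ G → (λ _ → 0#) ⊛ G ≋ λ _ → 0#
  ⊛-zeroˡ G zero    = zeroˡ _
  ⊛-zeroˡ G (suc n) = trans (+-cong (zeroˡ _) (⊛-zeroˡ G n)) (+-identityˡ _)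

  ⊛-identityˡ : ∀ G → one ⊛ G ≋ G
  ⊛-identityˡ G zero    = *-identityˡ _
  ⊛-identityˡ G (suc n) = trans (+-cong (*-identityˡ _) (⊛-zeroˡ G n)) (+-identityʳ _)

  powerSeriesRing : CommutativeRing c ℓ
  powerSeriesRing = record
    { _≈_ = _≋_
    ; _+_ = _⊕_
    ; _*_ = _⊛_
    ; -_  = λ F n → - F n
    ; 0#  = λ _ → 0#
    ; 1#  = one
    ; isCommutativeRing = record
      { isRing = record
        { +-isAbelianGroup = Pointwise.isAbelianGroup ℕ +-isAbelianGroup
        ; *-cong     = ⊛-cong
        ; *-assoc    = ⊛-assoc
        ; *-identity = ⊛-identityˡ , λ G n → trans (⊛-comm G one n) (⊛-identityˡ G n)
        ; distrib    =
            (λ H F G n → trans (⊛-comm H (F ⊕ G) n)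
              (trans (⊛-distribʳ H F G n) (+-cong (⊛-comm F H n) (⊛-comm G H n))))
          , ⊛-distribʳ
        }
      ; *-comm = ⊛-comm
      }
    }

-- Inverses, quotients and signs in a commutative ring

module Inverses {c ℓ} (R : CommutativeRing c ℓ) where
  open CommutativeRing R
  open SetoidReasoning setoid
  open SemiringSolver commutativeSemiring using (solve; _:+_; _:*_; _:=_)
  open RingProperties ring

  -- The premise is the equation satisfied by the geometric series in x = 1 - f, which is how `inv`
  -- is defined. Since f + x = 1, cancelling x * i leaves the claim.
  fixpoint⇒inverse : ∀ f i → i ≈ 1# + (1# - f) * i → f * i ≈ 1#
  fixpoint⇒inverse f i e = +-cancelʳ (x * i) (f * i) 1# (begin
    f * i + x * i    ≈⟨ distribʳ i f x ⟨
    (f + x) * i       ≈⟨ *-congʳ (trans (sym (+-assoc f 1# (- f))) (xyx⁻¹≈y f 1#)) ⟩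
    1# * i             ≈⟨ *-identityˡ i ⟩
    i                   ≈⟨ e ⟩
    1# + x * i        ∎)
    where
    x = 1# - f

  divide : ∀ {f i u v} → f * i ≈ 1# → f * u ≈ v → u ≈ v * i
  divide {f} {i} {u} {v} fi fu = begin
    u               ≈⟨ *-identityʳ u ⟨
    u * 1#         ≈⟨ *-congˡ fi ⟨
    u * (f * i)   ≈⟨ solve 3 (λ u f i → u :* (f :* i) := (f :* u) :* i) refl u f i ⟩
    (f * u) * i   ≈⟨ *-congʳ fu ⟩
    v * i          ∎

  inverse-* : ∀ {f g h i j} → f * i ≈ 1# → g * j ≈ 1# → (f * g) * h ≈ 1# → h ≈ i * j
  inverse-* {f} {g} {h} {i} {j} fi gj fgh = sym (trans (divide fgh (begin
    (f * g) * (i * j)   ≈⟨ solve 4 (λ f g i j → (f :* g) :* (i :* j) := (f :* i) :* (g :* j)) refl f g i j ⟩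
    (f * i) * (g * j)   ≈⟨ *-cong fi gj ⟩
    1# * 1#               ≈⟨ *-identityˡ 1# ⟩
    1#                     ∎)) (*-identityˡ h))

  inverse-step : ∀ {f g i j} → f * i ≈ 1# → (f * g) * j ≈ 1# → i ≈ g * j
  inverse-step {f} {g} {i} {j} fi fgj =
    sym (trans (divide fi (trans (sym (*-assoc f g j)) fgj)) (*-identityˡ i))

  -- Every Pochhammer factor met below is 1 - x with x = -y. Reading it as 1 + y keeps the
  -- recurrences free of subtraction, as the semiring solver requires.
  neg-times : ∀ {x y} u → x ≈ - y → (1# - x) * u ≈ u + y * u
  neg-times {x} {y} u x≈-y = begin
    (1# - x) * u        ≈⟨ distribʳ u 1# (- x) ⟩
    1# * u + (- x) * u  ≈⟨ +-cong (*-identityˡ u) (*-congʳ (trans (-‿cong x≈-y) (-‿involutive y))) ⟩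
    u + y * u           ∎

  neg*neg : ∀ x y z → (- x) * ((- y) * z) ≈ x * (y * z)
  neg*neg x y z = begin
    (- x) * ((- y) * z)   ≈⟨ -‿distribˡ-* x ((- y) * z) ⟨
    - (x * ((- y) * z))   ≈⟨ -‿cong (*-congˡ (-‿distribˡ-* y z)) ⟨
    - (x * - (y * z))     ≈⟨ -‿cong (-‿distribʳ-* x (y * z)) ⟨
    - - (x * (y * z))     ≈⟨ -‿involutive (x * (y * z)) ⟩
    x * (y * z)           ∎

-- The telescoping identity behind f

module Telescope {c ℓ} (R : CommutativeRing c ℓ) where
  open CommutativeRing R hiding (zero)
  open SetoidReasoning setoid
  open SemiringSolver commutativeSemiring using (solve; _:+_; _:*_; _:=_; con)

  module Sums (α q : Carrier) (q^_ : ℕ → Carrier)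
           (q^zero : q^ 0 ≈ 1#) (q^suc : ∀ n → q^ (suc n) ≈ q * q^ n)
           (G H : ℕ → Carrier)
           (G-step : ∀ n → G n ≈ G (suc n) + q^ (suc n) * G (suc n))
           (H-step : ∀ n → H n ≈ H (suc n) + α * (q^ (suc n) * H (suc n)))
           (H-zero : H 0 ≈ 1#)
    where

    q^-+ : ∀ m n → q^ (m ℕ.+ n) ≈ q^ m * q^ n
    q^-+ zero    n = sym (trans (*-congʳ q^zero) (*-identityˡ (q^ n)))
    q^-+ (suc m) n = begin
      q^ (suc (m ℕ.+ n))    ≈⟨ q^suc (m ℕ.+ n) ⟩
      q * q^ (m ℕ.+ n)      ≈⟨ *-congˡ (q^-+ m n) ⟩
      q * (q^ m * q^ n)     ≈⟨ *-assoc q (q^ m) (q^ n) ⟨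
      q * q^ m * q^ n       ≈⟨ *-congʳ (q^suc m) ⟨
      q^ (suc m) * q^ n     ∎

    -- coeff r j = q^(j (j + r + 1)) α^j.
    coeff : ℕ → ℕ → Carrier
    coeff r zero    = 1#
    coeff r (suc j) = coeff r j * (α * (q^ (suc j) * q^ (suc (j ℕ.+ r))))

    coeff-suc : ∀ r j → coeff (suc r) j ≈ coeff r j * q^ j
    coeff-suc r zero    = sym (trans (*-identityˡ (q^ 0)) q^zero)
    coeff-suc r (suc j) = begin
      coeff (suc r) j * (α * (q^ (suc j) * q^ (suc (j ℕ.+ suc r))))
        ≈⟨ *-cong (coeff-suc r j) (*-congˡ (*-congˡ (trans (reflexive (≡.cong (λ n → q^ suc n) (ℕ.+-suc j r))) (q^suc (suc (j ℕ.+ r)))))) ⟩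
      coeff r j * q^ j * (α * (q^ (suc j) * (q * q^ (suc (j ℕ.+ r)))))
        ≈⟨ solve 6 (λ c x α y q z → c :* x :* (α :* (y :* (q :* z))) := c :* (α :* (y :* z)) :* (q :* x)) refl
             (coeff r j) (q^ j) α (q^ (suc j)) q (q^ (suc (j ℕ.+ r))) ⟩
      coeff r j * (α * (q^ (suc j) * q^ (suc (j ℕ.+ r)))) * (q * q^ j)
        ≈⟨ *-congˡ (q^suc j) ⟨
      coeff r (suc j) * q^ (suc j) ∎

    -- Here `a^_` stands for the powers of αq. As (j+1)^2 - (j+1) = j(j+1), the left side is the
    -- numerator of the term of f with index j + 1.
    coeff-closed : (a^_ : ℕ → Carrier) → a^ 0 ≈ 1# → (∀ n → a^ (suc n) ≈ α * q * a^ n) →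
      ∀ j → q^ (j ℕ.* suc j) * a^ (suc j) ≈ α * (q * coeff 1 j)
    coeff-closed a^_ a^zero a^suc zero = begin
      q^ 0 * a^ 1              ≈⟨ *-cong q^zero (trans (a^suc 0) (*-congˡ a^zero)) ⟩
      1# * (α * q * 1#)        ≈⟨ solve 2 (λ α q → con 1 :* (α :* q :* con 1) := α :* (q :* con 1)) refl α q ⟩
      α * (q * 1#)             ∎
    coeff-closed a^_ a^zero a^suc (suc j) = begin
      q^ (suc j ℕ.* suc (suc j)) * a^ (suc (suc j))
        ≈⟨ *-cong (reflexive (≡.cong q^_ (exponent j))) (a^suc (suc j)) ⟩
      q^ (j ℕ.* suc j ℕ.+ (suc j ℕ.+ suc j)) * (α * q * a^ (suc j))
        ≈⟨ *-congʳ (trans (q^-+ (j ℕ.* suc j) (suc j ℕ.+ suc j)) (*-congˡ (q^-+ (suc j) (suc j)))) ⟩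
      q^ (j ℕ.* suc j) * (y * y) * (α * q * a^ (suc j))
        ≈⟨ solve 5 (λ x y α q a → x :* (y :* y) :* (α :* q :* a) := (x :* a) :* (α :* (y :* (q :* y)))) refl
             (q^ (j ℕ.* suc j)) y α q (a^ (suc j)) ⟩
      q^ (j ℕ.* suc j) * a^ (suc j) * (α * (y * (q * y)))
        ≈⟨ *-congʳ (coeff-closed a^_ a^zero a^suc j) ⟩
      α * (q * coeff 1 j) * (α * (y * (q * y)))
        ≈⟨ trans (*-assoc α (q * coeff 1 j) _) (*-congˡ (*-assoc q (coeff 1 j) _)) ⟩
      α * (q * (coeff 1 j * (α * (y * (q * y)))))
        ≈⟨ *-congˡ (*-congˡ (*-congˡ (*-congˡ (*-congˡ
             (trans (reflexive (≡.cong (λ n → q^ suc n) (ℕ.+-comm j 1))) (q^suc (suc j))))))) ⟨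
      α * (q * coeff 1 (suc j)) ∎
      where
      y = q^ (suc j)
      exponent : ∀ j → suc j ℕ.* suc (suc j) ≡.≡ j ℕ.* suc j ℕ.+ (suc j ℕ.+ suc j)
      exponent = ℕSolver.solve-∀

    b u : ℕ → ℕ → Carrier
    b r j = coeff r j * (H (suc j) * G (j ℕ.+ r))
    u r j = coeff r j * (H j * G (j ℕ.+ r))

    -- Put y = αq^(j+1) and z = q^(j+r+1). After `G-step` and `H-step` the three summands on the
    -- left are a common factor times 1 + z, y z and y, and the right side is that factor times (1 +
    -- y)(1 + z).
    step : ∀ r j → b r j + u r (suc j) + α * (q * b (suc r) j) ≈ u r j
    step r j = begin
      b r j + u r (suc j) + α * (q * b (suc r) j)
        ≈⟨ +-cong (+-congʳ (*-congˡ (*-congˡ (G-step (j ℕ.+ r)))))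
             (*-congˡ (*-congˡ (*-cong (coeff-suc r j) (*-congˡ (reflexive (≡.cong G (ℕ.+-suc j r))))))) ⟩
      w * (h * (g + z * g)) + w * (α * (q^ (suc j) * z)) * (h * g) + α * (q * (w * q^ j * (h * g)))
        ≈⟨ +-congʳ (+-congˡ (*-congʳ (*-congˡ (*-congˡ (*-congʳ (q^suc j)))))) ⟩
      w * (h * (g + z * g)) + w * (α * (q * q^ j * z)) * (h * g) + α * (q * (w * q^ j * (h * g)))
        ≈⟨ solve 7 (λ c h g z α q x →
             c :* (h :* (g :+ z :* g)) :+ c :* (α :* (q :* x :* z)) :* (h :* g) :+ α :* (q :* (c :* x :* (h :* g)))
               := c :* ((h :+ α :* (q :* x :* h)) :* (g :+ z :* g))) refl w h g z α q (q^ j) ⟩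
      w * ((h + α * (q * q^ j * h)) * (g + z * g))
        ≈⟨ *-congˡ (*-cong (trans (H-step j) (+-congˡ (*-congˡ (*-congʳ (q^suc j))))) (G-step (j ℕ.+ r))) ⟨
      u r j ∎
      where
      w = coeff r j
      h = H (suc j)
      g = G (suc (j ℕ.+ r))
      z = q^ (suc (j ℕ.+ r))

    B : ℕ → ℕ → Carrier
    B r zero    = 0#
    B r (suc J) = B r J + b r J

    -- The partial sums up to J satisfy an exact identity with remainder `u r J`; `u-order` later
    -- removes the remainder from each fixed coefficient. The value G r comes from the initial term
    -- `u r 0`.
    telescope : ∀ r J → B r J + u r J + α * (q * B (suc r) J) ≈ G r
    telescope r zero = begin
      0# + 1# * (H 0 * G r) + α * (q * 0#)
        ≈⟨ +-cong (+-congˡ (*-congˡ (*-congʳ H-zero))) (trans (*-congˡ (zeroʳ q)) (zeroʳ α)) ⟩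
      0# + 1# * (1# * G r) + 0#
        ≈⟨ solve 1 (λ g → con 0 :+ con 1 :* (con 1 :* g) :+ con 0 := g) refl (G r) ⟩
      G r ∎
    telescope r (suc J) = begin
      B r J + b r J + u r (suc J) + α * (q * (B (suc r) J + b (suc r) J))
        ≈⟨ solve 7 (λ x y z α q v w → x :+ y :+ z :+ α :* (q :* (v :+ w)) := x :+ (y :+ z :+ α :* (q :* w)) :+ α :* (q :* v))
             refl (B r J) (b r J) (u r (suc J)) α q (B (suc r) J) (b (suc r) J) ⟩
      B r J + (b r J + u r (suc J) + α * (q * b (suc r) J)) + α * (q * B (suc r) J)
        ≈⟨ +-congʳ (+-congˡ (step r J)) ⟩
      B r J + u r J + α * (q * B (suc r) J)
        ≈⟨ telescope r J ⟩
      G r ∎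

-- Gaussian binomials and distinct odd parts

module OddPascal {c ℓ} (R : CommutativeRing c ℓ) where
  open CommutativeRing R hiding (zero)
  open SetoidReasoning setoid
  open SemiringSolver commutativeSemiring using (solve; _:+_; _:*_; _:=_; con)

  module Powers (q : Carrier) (q^_ : ℕ → Carrier)
           (q^zero : q^ 0 ≈ 1#) (q^suc : ∀ n → q^ (suc n) ≈ q * q^ n)
    where

    -- D n c enumerates the partitions into n distinct odd parts below 2c. Its definition splits on
    -- the part 2c + 1; pascal splits on the part 1 and then decreases the other parts by 2.
    D : ℕ → ℕ → Carrier
    D zero    c       = 1#
    D (suc n) zero    = 0#
    D (suc n) (suc c) = D (suc n) c + q^ (suc (c ℕ.* 2)) * D n c

    private
      q^suc² : ∀ n → q^ (suc (suc n)) ≈ q * (q * q^ n)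
      q^suc² n = trans (q^suc (suc n)) (*-congˡ (q^suc n))

    -- `D n c` is q^(n^2) times the Gaussian binomial of c over n in base q^2, and this is the
    -- second of its two Pascal rules. Induction on c pushes it through the first one, which is the
    -- definition.
    pascal : ∀ n c → D (suc n) (suc c) ≈ q^ (suc n ℕ.* 2) * D (suc n) c + q^ (suc (n ℕ.* 2)) * D n c
    pascal zero zero    = +-congʳ (sym (zeroʳ _))
    pascal (suc n) zero = +-cong (sym (zeroʳ _)) (trans (zeroʳ _) (sym (zeroʳ _)))
    pascal zero (suc c) = begin
      D 1 (suc c) + q^ (suc (suc (suc (c ℕ.* 2)))) * 1#
        ≈⟨ +-cong (trans (pascal zero c) (+-congʳ (*-congʳ (q^suc² 0)))) (*-congʳ (q^suc² (suc (c ℕ.* 2)))) ⟩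
      q * (q * q^ 0) * D 1 c + q^ 1 * 1# + q * (q * x) * 1#
        ≈⟨ +-congʳ (+-congʳ (*-congʳ (*-congˡ (*-congˡ q^zero)))) ⟩
      q * (q * 1#) * D 1 c + q^ 1 * 1# + q * (q * x) * 1#
        ≈⟨ solve 4 (λ q d z x → q :* (q :* con 1) :* d :+ z :* con 1 :+ q :* (q :* x) :* con 1
             := q :* (q :* con 1) :* (d :+ x :* con 1) :+ z :* con 1) refl q (D 1 c) (q^ 1) x ⟩
      q * (q * 1#) * (D 1 c + x * 1#) + q^ 1 * 1#
        ≈⟨ +-congʳ (*-congʳ (*-congˡ (*-congˡ q^zero))) ⟨
      q * (q * q^ 0) * (D 1 c + x * 1#) + q^ 1 * 1#
        ≈⟨ +-congʳ (*-congʳ (q^suc² 0)) ⟨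
      q^ 2 * D 1 (suc c) + q^ 1 * 1# ∎
      where
      x = q^ (suc (c ℕ.* 2))
    pascal (suc n) (suc c) = begin
      D (suc (suc n)) (suc c) + q^ (suc (suc (suc (c ℕ.* 2)))) * D (suc n) (suc c)
        ≈⟨ +-cong (pascal (suc n) c) (*-cong (q^suc² (suc (c ℕ.* 2))) (pascal n c)) ⟩
      (q^ (suc (suc n) ℕ.* 2) * d₂ + q^ (suc (suc n ℕ.* 2)) * d₁) + q * (q * x) * (q^ (suc n ℕ.* 2) * d₁ + q^ (suc (n ℕ.* 2)) * d₀)
        -- The solver does not relate different powers of q, so all of them are brought down to `x`
        -- = q^(2c+1) and `z` = q^(2n+1).
        ≈⟨ +-cong (+-cong (*-congʳ (q^suc² _)) (*-congʳ (q^suc _)))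
             (*-congˡ (+-congˡ (*-congʳ refl))) ⟩
      (q * (q * y) * d₂ + q * y * d₁) + q * (q * x) * (y * d₁ + z * d₀)
        ≈⟨ +-congˡ (*-congˡ (+-congʳ (*-congʳ (q^suc _)))) ⟩
      (q * (q * y) * d₂ + q * y * d₁) + q * (q * x) * (q * z * d₁ + z * d₀)
        ≈⟨ +-congʳ (+-cong (*-congʳ (*-congˡ (*-congˡ (q^suc _)))) (*-congʳ (*-congˡ (q^suc _)))) ⟩
      (q * (q * (q * z)) * d₂ + q * (q * z) * d₁) + q * (q * x) * (q * z * d₁ + z * d₀)
        ≈⟨ solve 6 (λ q x z d₀ d₁ d₂ →
             (q :* (q :* (q :* z)) :* d₂ :+ q :* (q :* z) :* d₁) :+ q :* (q :* x) :* (q :* z :* d₁ :+ z :* d₀)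
               := q :* (q :* (q :* z)) :* (d₂ :+ x :* d₁) :+ q :* (q :* z) :* (d₁ :+ x :* d₀)) refl q x z d₀ d₁ d₂ ⟩
      q * (q * (q * z)) * (d₂ + x * d₁) + q * (q * z) * (d₁ + x * d₀)
        ≈⟨ +-cong (*-congʳ (trans (q^suc² _) (*-congˡ (*-congˡ (q^suc _)))))
                  (*-congʳ (trans (q^suc _) (*-congˡ (q^suc _)))) ⟨
      q^ (suc (suc n) ℕ.* 2) * D (suc (suc n)) (suc c) + q^ (suc (suc n ℕ.* 2)) * D (suc n) (suc c) ∎
      where
      x = q^ (suc (c ℕ.* 2))
      y = q^ (suc n ℕ.* 2)
      z = q^ (suc (n ℕ.* 2))
      d₀ = D n c
      d₁ = D (suc n) c
      d₂ = D (suc (suc n)) c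

open import Defs
open import Algebra.Bundles.Raw using (RawRing)
open import Algebra.Morphism.Structures using (IsRingMonomorphism)
import Algebra.Morphism.RingMonomorphism as RingMonomorphism
import Algebra.Properties.CommutativeSemigroup as CommutativeSemigroupProperties
open import Data.Bool using (Bool; true; false; if_then_else_; _∧_)
import Data.Bool.Properties as Bool
open import Data.Integer as ℤ using (ℤ; +_; _+_; _*_; -_; _-_)
import Data.Integer.Properties as ℤ
open import Data.List using (List; []; _∷_; foldr; map; applyUpTo; upTo; length; _++_; concatMap)
import Data.List.Properties as List
open import Data.List.Membership.Propositional using (_∈_)
open import Data.List.Relation.Unary.All using (All; []; _∷_)
import Data.List.Relation.Unary.All.Properties as All
open import Data.List.Relation.Unary.Any using (here; there)
open import Data.List.Relation.Unary.Linked using (Linked; [-]; _∷_)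
import Data.Nat.DivMod as ℕ
open import Data.Nat.ListAction using (sum)
open import Data.Sum using (_⊎_; inj₁; inj₂)
open import Data.Unit using (tt)
open import Level using (0ℓ)
open import Relation.Binary.PropositionalEquality hiding ([_]; J)
open import Relation.Nullary using (¬_; Dec; yes; no; does; contradiction)
open import Relation.Nullary.Decidable using (_×-dec_; _⊎-dec_; does-⇔; dec-false; dec-true)

-- The ring of series in q and α

Σ< : ℕ → (ℕ → ℤ) → ℤ
Σ< zero    f = + 0
Σ< (suc n) f = f 0 + Σ< n (f ∘ suc)

Σ<-cong : ∀ n {f g : ℕ → ℤ} → (∀ i → i < n → f i ≡ g i) → Σ< n f ≡ Σ< n g
Σ<-cong zero    e = refl
Σ<-cong (suc n) e = cong₂ _+_ (e 0 (s≤s z≤n)) (Σ<-cong n (λ i i<n → e (suc i) (s≤s i<n)))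

foldr-upTo : ∀ n (f : ℕ → ℤ) → foldr _+_ (+ 0) (map f (upTo n)) ≡ Σ< n f
foldr-upTo n f = trans (cong (foldr _+_ (+ 0)) (List.map-applyUpTo id f n)) (go n f)
  where
  go : ∀ n (f : ℕ → ℤ) → foldr _+_ (+ 0) (applyUpTo f n) ≡ Σ< n f
  go zero    f = refl
  go (suc n) f = cong (_+_ (f 0)) (go n (f ∘ suc))

Σ≤≡Σ< : ∀ n f → Σ≤ n f ≡ Σ< (suc n) f
Σ≤≡Σ< n f = foldr-upTo (suc n) f

-- `Outer` has q as its variable and series in α as coefficients, in the order of the indices of
-- `F N k`. `Inner` also serves later for series in q alone.
module Inner = PowerSeries ℤ.+-*-commutativeRing
module Outer = PowerSeries Inner.powerSeriesRing

inner-⊛ : ∀ F G n → (F Inner.⊛ G) n ≡ Σ< (suc n) (λ j → F j * G (n ∸ j))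
inner-⊛ F G zero    = sym (ℤ.+-identityʳ _)
inner-⊛ F G (suc n) = cong (_+_ (F 0 * G (suc n))) (inner-⊛ (F ∘ suc) G n)

outer-⊛ : ∀ F G n k → (F Outer.⊛ G) n k ≡ Σ< (suc n) (λ i → (F i Inner.⊛ G (n ∸ i)) k)
outer-⊛ F G zero    k = sym (ℤ.+-identityʳ _)
outer-⊛ F G (suc n) k = cong (_+_ ((F 0 Inner.⊛ G (suc n)) k)) (outer-⊛ (F ∘ suc) G n k)

*s≈⊛ : ∀ F G → F *s G ≈s F Outer.⊛ G
*s≈⊛ F G n k = begin
  (F *s G) n k
    ≡⟨ Σ≤≡Σ< n (λ i → Σ≤ k (summand i)) ⟩
  Σ< (suc n) (λ i → Σ≤ k (summand i))
    ≡⟨ Σ<-cong (suc n) (λ i _ → trans (Σ≤≡Σ< k (summand i)) (sym (inner-⊛ (F i) (G (n ∸ i)) k))) ⟩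
  Σ< (suc n) (λ i → (F i Inner.⊛ G (n ∸ i)) k)
    ≡⟨ outer-⊛ F G n k ⟨
  (F Outer.⊛ G) n k ∎
  where
  open ≡-Reasoning
  summand : ℕ → ℕ → ℤ
  summand i j = F i j * G (n ∸ i) (k ∸ j)

serRawRing : RawRing 0ℓ 0ℓ
serRawRing = record { _≈_ = _≈s_ ; _+_ = _+s_ ; _*_ = _*s_ ; -_ = -s_ ; 0# = 0s ; 1# = 1s }

1s≈one : 1s ≈s Outer.one
1s≈one zero    zero    = refl
1s≈one zero    (suc k) = refl
1s≈one (suc n) k       = refl

-- The product `*s` is a fold over lists, awkward for proving ring laws. Along the identity map they
-- are pulled back from the nested power series ring.
serRing-embedding :
  IsRingMonomorphism serRawRing (CommutativeRing.rawRing Outer.powerSeriesRing) id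
serRing-embedding = record
  { isRingHomomorphism = record
    { isSemiringHomomorphism = record
      { isNearSemiringHomomorphism = record
        { +-isMonoidHomomorphism = record
          { isMagmaHomomorphism = record
            { isRelHomomorphism = record { cong = id }
            ; homo = λ _ _ _ _ → refl }
          ; ε-homo = λ _ _ → refl }
        ; *-homo = *s≈⊛ }
      ; 1#-homo = 1s≈one }
    ; -‿homo = λ _ _ _ → refl }
  ; injective = id }

serRing : CommutativeRing 0ℓ 0ℓ
serRing = record
  { isCommutativeRing = RingMonomorphism.isCommutativeRing serRing-embedding
      (CommutativeRing.isCommutativeRing Outer.powerSeriesRing) }

module 𝕊 = CommutativeRing serRing
open Inverses serRing
module 𝕊-Reasoning = SetoidReasoning 𝕊.setoid

-- Finite sums of integers

Σ<-zero : ∀ n {f : ℕ → ℤ} → (∀ i → i < n → f i ≡ + 0) → Σ< n f ≡ + 0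
Σ<-zero zero    e = refl
Σ<-zero (suc n) e = cong₂ _+_ (e 0 (s≤s z≤n)) (Σ<-zero n (λ i i<n → e (suc i) (s≤s i<n)))

Σ<-pad : ∀ {m n} {f : ℕ → ℤ} → m ≤ n → (∀ i → m ≤ i → f i ≡ + 0) → Σ< n f ≡ Σ< m f
Σ<-pad {n = n} z≤n e = Σ<-zero n (λ i _ → e i z≤n)
Σ<-pad {f = f} (s≤s m≤n) e = cong (_+_ (f 0)) (Σ<-pad m≤n (λ i m≤i → e (suc i) (s≤s m≤i)))

Σ<-snoc : ∀ n f → Σ< (suc n) f ≡ Σ< n f + f n
Σ<-snoc zero    f = trans (ℤ.+-identityʳ (f 0)) (sym (ℤ.+-identityˡ (f 0)))
Σ<-snoc (suc n) f = trans (cong (_+_ (f 0)) (Σ<-snoc n (f ∘ suc))) (sym (ℤ.+-assoc (f 0) _ _))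

Σ<-* : ∀ n s f → Σ< n (λ i → s * f i) ≡ s * Σ< n f
Σ<-* zero    s f = sym (ℤ.*-zeroʳ s)
Σ<-* (suc n) s f = trans (cong (_+_ (s * f 0)) (Σ<-* n s (f ∘ suc))) (sym (ℤ.*-distribˡ-+ s (f 0) _))

Σ<-+ : ∀ n f g → Σ< n (λ i → f i + g i) ≡ Σ< n f + Σ< n g
Σ<-+ zero    f g = refl
Σ<-+ (suc n) f g = trans (cong (_+_ (f 0 + g 0)) (Σ<-+ n (f ∘ suc) (g ∘ suc)))
  (ℤ+.interchange (f 0) (g 0) (Σ< n (f ∘ suc)) (Σ< n (g ∘ suc)))
  where module ℤ+ = CommutativeSemigroupProperties ℤ.+-commutativeSemigroup

-- The premise covers an index m outside the range: the sum is then zero, so `T m` must vanish by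
-- itself. This spares its users a case distinction.
Σ<-single : ∀ n m (T : ℕ → ℤ) → (n ≤ m → T m ≡ + 0) →
  Σ< n (λ i → if does (i ℕ.≟ m) then T i else + 0) ≡ T m
Σ<-single zero    m       T e = sym (e z≤n)
Σ<-single (suc n) zero    T e = trans (cong (_+_ (T 0)) (Σ<-zero n (λ _ _ → refl))) (ℤ.+-identityʳ (T 0))
Σ<-single (suc n) (suc m) T e = trans (ℤ.+-identityˡ _) (Σ<-single n m (T ∘ suc) (λ n≤m → e (s≤s n≤m)))

Σ<-restrict : ∀ {m b} (f : ℕ → ℤ) → m ≤ b →
  Σ< b (λ y → if does (suc y ℕ.≤? m) then f y else + 0) ≡ Σ< m f
Σ<-restrict {m} f m≤b = trans
  (Σ<-pad m≤b (λ y m≤y → cong (if_then f y else + 0) (dec-false (suc y ℕ.≤? m) (ℕ.<⇒≱ (s≤s m≤y)))))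
  (Σ<-cong m (λ y y<m → cong (if_then f y else + 0) (dec-true (suc y ℕ.≤? m) y<m)))

Σ<-single< : ∀ n m (T : ℕ → ℤ) → m < n → Σ< n (λ i → if does (i ℕ.≟ m) then T i else + 0) ≡ T m
Σ<-single< n m T m<n = Σ<-single n m T (λ n≤m → contradiction m<n (ℕ.≤⇒≯ n≤m))

Σ<-swap : ∀ m n (f : ℕ → ℕ → ℤ) → Σ< m (λ i → Σ< n (f i)) ≡ Σ< n (λ j → Σ< m (λ i → f i j))
Σ<-swap zero    n f = sym (Σ<-zero n (λ _ _ → refl))
Σ<-swap (suc m) n f = trans (cong (_+_ (Σ< n (f 0))) (Σ<-swap m n (f ∘ suc)))
  (sym (Σ<-+ n (f 0) (λ j → Σ< m (λ i → f (suc i) j))))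

-- Truncation by total degree, and geometric inverses

infix 4 _≈[_]_
_≈[_]_ : Ser → ℕ → Ser → Set
F ≈[ d ] G = ∀ N k → N ℕ.+ k < d → F N k ≡ G N k

*s-Σ< : ∀ F G N k →
  (F *s G) N k ≡ Σ< (suc N) (λ i → Σ< (suc k) (λ j → F i j * G (N ∸ i) (k ∸ j)))
*s-Σ< F G N k = trans (Σ≤≡Σ< N (λ i → Σ≤ k (λ j → F i j * G (N ∸ i) (k ∸ j))))
  (Σ<-cong (suc N) (λ i _ → Σ≤≡Σ< k (λ j → F i j * G (N ∸ i) (k ∸ j))))

*s-cong[] : ∀ {d F F′ G G′} → F ≈[ d ] F′ → G ≈[ d ] G′ → F *s G ≈[ d ] F′ *s G′
*s-cong[] {d} {F} {F′} {G} {G′} p r N k Nk<d = begin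
  (F *s G) N k      ≡⟨ *s-Σ< F G N k ⟩
  _                 ≡⟨ Σ<-cong (suc N) (λ i i≤N → Σ<-cong (suc k) (λ j j≤k →
                         cong₂ _*_
                           (p i j (ℕ.≤-<-trans (ℕ.+-mono-≤ (ℕ.≤-pred i≤N) (ℕ.≤-pred j≤k)) Nk<d))
                           (r (N ∸ i) (k ∸ j) (ℕ.≤-<-trans (ℕ.+-mono-≤ (ℕ.m∸n≤m N i) (ℕ.m∸n≤m k j)) Nk<d)))) ⟩
  _                 ≡⟨ *s-Σ< F′ G′ N k ⟨
  (F′ *s G′) N k    ∎
  where open ≡-Reasoning

-- In each summand the total degrees of the two factors add up to N + k < a + b, so one of them is
-- below its bound.
*s-order : ∀ {a b F G} → F ≈[ a ] 0s → G ≈[ b ] 0s → F *s G ≈[ a ℕ.+ b ] 0s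
*s-order {a} {b} {F} {G} p r N k Nk<ab =
  trans (*s-Σ< F G N k) (Σ<-zero (suc N) (λ i i≤N → Σ<-zero (suc k) (λ j j≤k →
    term i j (ℕ.≤-pred i≤N) (ℕ.≤-pred j≤k))))
  where
  complement : ∀ {i j} → i ≤ N → j ≤ k → (i ℕ.+ j) ℕ.+ ((N ∸ i) ℕ.+ (k ∸ j)) ≡ N ℕ.+ k
  complement {i} {j} i≤N j≤k = trans (ℕ+.interchange i j (N ∸ i) (k ∸ j))
    (cong₂ ℕ._+_ (ℕ.m+[n∸m]≡n i≤N) (ℕ.m+[n∸m]≡n j≤k))
    where module ℕ+ = CommutativeSemigroupProperties ℕ.+-commutativeSemigroup

  term : ∀ i j → i ≤ N → j ≤ k → F i j * G (N ∸ i) (k ∸ j) ≡ + 0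
  term i j i≤N j≤k with i ℕ.+ j ℕ.<? a
  ... | yes ij<a = trans (cong (_* G (N ∸ i) (k ∸ j)) (p i j ij<a)) (ℤ.*-zeroˡ (G (N ∸ i) (k ∸ j)))
  ... | no  ij≮a = trans (cong (_*_ (F i j)) (r (N ∸ i) (k ∸ j) (ℕ.+-cancelˡ-< a _ _
    (ℕ.≤-<-trans (ℕ.+-monoˡ-≤ _ (ℕ.≮⇒≥ ij≮a)) (subst (_< a ℕ.+ b) (sym (complement i≤N j≤k)) Nk<ab)))))
    (ℤ.*-zeroʳ (F i j))

^s-order : ∀ {X} → X 0 0 ≡ + 0 → ∀ m → X ^s m ≈[ m ] 0s
^s-order         e zero    N k ()
^s-order {X = X} e (suc m) = *s-order {1} {m} {X} {X ^s m}
  (λ { zero zero _ → e ; zero (suc k) (s≤s ()) ; (suc N) k (s≤s ()) }) (^s-order {X} e m)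

sumS : ℕ → (ℕ → Ser) → Ser
sumS n T N k = Σ< n (λ i → T i N k)

*s-distrib-sumS : ∀ F n T → F *s sumS n T ≈s sumS n (λ i → F *s T i)
*s-distrib-sumS F zero    T = 𝕊.zeroʳ F
*s-distrib-sumS F (suc n) T N k = trans (𝕊.distribˡ F (T 0) (sumS n (T ∘ suc)) N k)
  (cong (_+_ ((F *s T 0) N k)) (*s-distrib-sumS F n (T ∘ suc) N k))

inv-inverse : ∀ {F} → F 0 0 ≡ + 1 → F *s inv F ≈s 1s
inv-inverse {F} F00≡1 = fixpoint⇒inverse F (inv F) fixpoint
  where
  X = 1s -s F

  X00≡0 : X 0 0 ≡ + 0
  X00≡0 = trans (cong (λ c → + 1 + (- c)) F00≡1) refl

  partial : ∀ n → inv F ≈[ n ] sumS n (X ^s_)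
  partial n N k Nk<n = trans (Σ≤≡Σ< (N ℕ.+ k) (λ m → (X ^s m) N k))
    (sym (Σ<-pad Nk<n (λ i Nk<i → ^s-order {X} X00≡0 i N k Nk<i)))

  fixpoint : inv F ≈s 1s +s X *s inv F
  fixpoint N k = begin
    -- One extra term is taken: once the power 0 is split off, the rest is `X` times a partial sum
    -- that still covers total degree N + k.
    inv F N k                                          ≡⟨ partial (suc n) N k (ℕ.m<n⇒m<1+n ℕ.≤-refl) ⟩
    1s N k + sumS n (λ m → X *s X ^s m) N k            ≡⟨ cong (_+_ (1s N k)) (*s-distrib-sumS X n (X ^s_) N k) ⟨
    1s N k + (X *s sumS n (X ^s_)) N k                 ≡⟨ cong (_+_ (1s N k)) (*s-cong[] {n} {X} {X} {inv F} {sumS n (X ^s_)} (λ _ _ _ → refl) (partial n) N k ℕ.≤-refl) ⟨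
    1s N k + (X *s inv F) N k                          ∎
    where
    open ≡-Reasoning
    n = suc (N ℕ.+ k)

-- Multiplication by powers of a variable

-- Multiplication by the a-th power of q or of α, on coefficients. The recursion avoids truncated
-- subtraction, which would confuse indices below a with index 0.
shift : ℕ → (ℕ → ℤ) → ℕ → ℤ
shift zero    f N       = f N
shift (suc a) f zero    = + 0
shift (suc a) f (suc N) = shift a f N

-- Only arguments M with a + M ≤ N are consulted, so equalities that hold below a degree bound can
-- be used under a shift.
shift-cong≤ : ∀ a {f g} N → (∀ M → a ℕ.+ M ≤ N → f M ≡ g M) → shift a f N ≡ shift a g N
shift-cong≤ zero    N       e = e N ℕ.≤-refl
shift-cong≤ (suc a) zero    e = refl
shift-cong≤ (suc a) (suc N) e = shift-cong≤ a N (λ M aM≤N → e M (s≤s aM≤N))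

shift-cong : ∀ a {f g} → (∀ M → f M ≡ g M) → ∀ N → shift a f N ≡ shift a g N
shift-cong a e N = shift-cong≤ a N (λ M _ → e M)

shift-small : ∀ a f {N} → N < a → shift a f N ≡ + 0
shift-small (suc a) f {zero}  _         = refl
shift-small (suc a) f {suc N} (s≤s N<a) = shift-small a f N<a

shift-zero≤ : ∀ a {f} N → (∀ M → a ℕ.+ M ≤ N → f M ≡ + 0) → shift a f N ≡ + 0
shift-zero≤ zero    N       e = e N ℕ.≤-refl
shift-zero≤ (suc a) zero    e = refl
shift-zero≤ (suc a) (suc N) e = shift-zero≤ a N (λ M aM≤N → e M (s≤s aM≤N))

shift-shift : ∀ a b f N → shift a (shift b f) N ≡ shift (a ℕ.+ b) f N
shift-shift zero    b f N       = refl
shift-shift (suc a) b f zero    = refl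
shift-shift (suc a) b f (suc N) = shift-shift a b f N

shift-+ : ∀ a f g N → shift a (λ M → f M + g M) N ≡ shift a f N + shift a g N
shift-+ zero    f g N       = refl
shift-+ (suc a) f g zero    = refl
shift-+ (suc a) f g (suc N) = shift-+ a f g N

shift-* : ∀ a s f N → shift a (λ M → s * f M) N ≡ s * shift a f N
shift-* zero    s f N       = refl
shift-* (suc a) s f zero    = sym (ℤ.*-zeroʳ s)
shift-* (suc a) s f (suc N) = shift-* a s f N

shift-Σ< : ∀ a n (f : ℕ → ℕ → ℤ) N → shift a (λ M → Σ< n (λ i → f i M)) N ≡ Σ< n (λ i → shift a (f i) N)
shift-Σ< zero    n f N       = refl
shift-Σ< (suc a) n f zero    = sym (Σ<-zero n (λ _ _ → refl))
shift-Σ< (suc a) n f (suc N) = shift-Σ< a n f N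

open Inner using () renaming (one to δ₀; _⊛_ to _⊛₁_)
open Outer using () renaming (_⊛_ to _⊛₂_)

δ₀≡1s : ∀ N → δ₀ N ≡ 1s N 0
δ₀≡1s zero    = refl
δ₀≡1s (suc N) = refl

0≟≡δ₀ : ∀ N → (if does (0 ℕ.≟ N) then + 1 else + 0) ≡ δ₀ N
0≟≡δ₀ zero    = refl
0≟≡δ₀ (suc N) = refl

xPow : ℕ → ℕ → ℤ
xPow n = shift n δ₀

x⊛ : ∀ f N → (xPow 1 ⊛₁ f) N ≡ shift 1 f N
x⊛ f zero    = ℤ.*-zeroˡ (f 0)
x⊛ f (suc N) = trans (cong₂ _+_ (ℤ.*-zeroˡ (f (suc N))) (Inner.⊛-identityˡ f N)) (ℤ.+-identityˡ (f N))

xPow-suc : ∀ n N → xPow (suc n) N ≡ (xPow 1 ⊛₁ xPow n) N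
xPow-suc n N = trans (sym (shift-shift 1 n δ₀ N)) (sym (x⊛ (xPow n) N))

xPow⊛ : ∀ n f N → (xPow n ⊛₁ f) N ≡ shift n f N
xPow⊛ zero    f N = Inner.⊛-identityˡ f N
xPow⊛ (suc n) f N = begin
  (xPow (suc n) ⊛₁ f) N             ≡⟨ Inner.⊛-cong {xPow (suc n)} {xPow 1 ⊛₁ xPow n} {f} (xPow-suc n) (λ _ → refl) N ⟩
  ((xPow 1 ⊛₁ xPow n) ⊛₁ f) N       ≡⟨ Inner.⊛-assoc (xPow 1) (xPow n) f N ⟩
  (xPow 1 ⊛₁ (xPow n ⊛₁ f)) N       ≡⟨ x⊛ (xPow n ⊛₁ f) N ⟩
  shift 1 (xPow n ⊛₁ f) N           ≡⟨ shift-cong 1 (xPow⊛ n f) N ⟩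
  shift 1 (shift n f) N             ≡⟨ shift-shift 1 n f N ⟩
  shift (suc n) f N                 ∎
  where open ≡-Reasoning

qS* : ∀ F N k → (qS *s F) N k ≡ shift 1 (λ M → F M k) N
qS* F zero    k = trans (*s≈⊛ qS F 0 k) (trans (Inner.⊛-cong {qS 0} {λ _ → + 0} {F 0} (λ _ → refl) (λ _ → refl) k) (Inner.⊛-zeroˡ (F 0) k))
qS* F (suc N) k = trans (*s≈⊛ qS F (suc N) k) (begin
  (qS 0 ⊛₁ F (suc N)) k + ((qS ∘ suc) ⊛₂ F) N k
    ≡⟨ cong₂ _+_
         (trans (Inner.⊛-cong {qS 0} {λ _ → + 0} {F (suc N)} (λ _ → refl) (λ _ → refl) k) (Inner.⊛-zeroˡ (F (suc N)) k))
         (Outer.⊛-cong {qS ∘ suc} {Outer.one} {F} {F} qS∘suc≈one (λ _ _ → refl) N k) ⟩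
  + 0 + (Outer.one ⊛₂ F) N k
    ≡⟨ trans (ℤ.+-identityˡ _) (Outer.⊛-identityˡ F N k) ⟩
  F N k ∎)
  where
  open ≡-Reasoning
  qS∘suc≈one : ∀ n j → qS (suc n) j ≡ Outer.one n j
  qS∘suc≈one zero    zero    = refl
  qS∘suc≈one zero    (suc j) = refl
  qS∘suc≈one (suc n) j       = refl

αS* : ∀ F N k → (αS *s F) N k ≡ shift 1 (F N) k
αS* F N k = trans (*s≈⊛ αS F N k) (trans (go N) (trans
  (Inner.⊛-cong {αS 0} {xPow 1} {F N} αS0≈x (λ _ → refl) k) (x⊛ (F N) k)))
  where
  αS0≈x : ∀ j → αS 0 j ≡ xPow 1 j
  αS0≈x zero          = refl
  αS0≈x (suc zero)    = refl
  αS0≈x (suc (suc j)) = refl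

  go : ∀ N → (αS ⊛₂ F) N k ≡ (αS 0 ⊛₁ F N) k
  go zero    = refl
  go (suc N) = trans
    (cong (_+_ ((αS 0 ⊛₁ F (suc N)) k)) (trans
      (Outer.⊛-cong {αS ∘ suc} {λ _ _ → + 0} {F} {F} (λ _ _ → refl) (λ _ _ → refl) N k)
      (Outer.⊛-zeroˡ F N k)))
    (ℤ.+-identityʳ _)

qS^* : ∀ a F N k → (qS ^s a *s F) N k ≡ shift a (λ M → F M k) N
qS^* zero    F N k = 𝕊.*-identityˡ F N k
qS^* (suc a) F N k = begin
  ((qS *s qS ^s a) *s F) N k              ≡⟨ 𝕊.*-assoc qS (qS ^s a) F N k ⟩
  (qS *s (qS ^s a *s F)) N k              ≡⟨ qS* (qS ^s a *s F) N k ⟩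
  shift 1 (λ M → (qS ^s a *s F) M k) N    ≡⟨ shift-cong 1 (λ M → qS^* a F M k) N ⟩
  shift 1 (shift a (λ M → F M k)) N       ≡⟨ shift-shift 1 a (λ M → F M k) N ⟩
  shift (suc a) (λ M → F M k) N           ∎
  where open ≡-Reasoning

-- Signs, Pochhammer symbols and the substitution of -q

sgnℕ-suc : ∀ n x → sgnℕ (suc n) * x ≡ - (sgnℕ n * x)
sgnℕ-suc n x = trans (cong (_* x) (ℤ.-1*i≡-i (sgnℕ n))) (sym (ℤ.neg-distribˡ-* (sgnℕ n) x))

-- `sgn` sees only an absolute value. Lowering both arguments by one keeps their difference, and the
-- two signs dropped on the right cancel.
sgn-minus : ∀ m n → sgn (+ m - + n) ≡ sgnℕ m * sgnℕ n
sgn-minus m n rewrite ℤ.m-n≡m⊖n m n = go m n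
  where
  go : ∀ m n → sgn (m ℤ.⊖ n) ≡ sgnℕ m * sgnℕ n
  go zero    zero    = refl
  go zero    (suc n) = sym (ℤ.*-identityˡ (sgnℕ (suc n)))
  go (suc m) zero    = sym (ℤ.*-identityʳ (sgnℕ (suc m)))
  go (suc m) (suc n) = begin
    sgn (suc m ℤ.⊖ suc n)                 ≡⟨ cong sgn (ℤ.[1+m]⊖[1+n]≡m⊖n m n) ⟩
    sgn (m ℤ.⊖ n)                         ≡⟨ go m n ⟩
    sgnℕ m * sgnℕ n                       ≡⟨ ℤ.neg-involutive (sgnℕ m * sgnℕ n) ⟨
    - (- (sgnℕ m * sgnℕ n))               ≡⟨ cong (-_) (ℤ.neg-distribʳ-* (sgnℕ m) (sgnℕ n)) ⟩
    - (sgnℕ m * (- sgnℕ n))               ≡⟨ sgnℕ-suc m (- sgnℕ n) ⟨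
    sgnℕ (suc m) * (- sgnℕ n)             ≡⟨ cong (_*_ (sgnℕ (suc m))) (ℤ.-1*i≡-i (sgnℕ n)) ⟨
    sgnℕ (suc m) * sgnℕ (suc n)           ∎
    where open ≡-Reasoning

*s-constant : ∀ F G → (F *s G) 0 0 ≡ F 0 0 * G 0 0
*s-constant F G = trans (ℤ.+-identityʳ _) (ℤ.+-identityʳ _)

poch-constant : ∀ {A} B → A 0 0 ≡ + 0 → ∀ n → poch A B n 0 0 ≡ + 1
poch-constant     B e zero    = refl
poch-constant {A} B e (suc n) = begin
  (poch A B n *s (1s -s A *s B ^s n)) 0 0
    ≡⟨ *s-constant (poch A B n) (1s -s A *s B ^s n) ⟩
  poch A B n 0 0 * (+ 1 + (- (A *s B ^s n) 0 0))
    ≡⟨ cong₂ (λ u v → u * (+ 1 + (- v))) (poch-constant {A} B e n)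
         (trans (*s-constant A (B ^s n)) (trans (cong (_* (B ^s n) 0 0) e) (ℤ.*-zeroˡ ((B ^s n) 0 0)))) ⟩
  + 1 ∎
  where open ≡-Reasoning

poch-inverse : ∀ A B → A 0 0 ≡ + 0 → ∀ n → poch A B n *s inv (poch A B n) ≈s 1s
poch-inverse A B e n = inv-inverse {poch A B n} (poch-constant {A} B e n)

^s-+ : ∀ F m n → F ^s (m ℕ.+ n) ≈s F ^s m *s F ^s n
^s-+ F zero    n = 𝕊.sym {1s *s F ^s n} {F ^s n} (𝕊.*-identityˡ (F ^s n))
^s-+ F (suc m) n = begin
  F *s F ^s (m ℕ.+ n)          ≈⟨ 𝕊.*-congˡ {F} {F ^s (m ℕ.+ n)} {F ^s m *s F ^s n} (^s-+ F m n) ⟩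
  F *s (F ^s m *s F ^s n)      ≈⟨ 𝕊.*-assoc F (F ^s m) (F ^s n) ⟨
  F ^s suc m *s F ^s n         ∎
  where open 𝕊-Reasoning

neg-odd-power : ∀ F n → (-s F) ^s suc (n ℕ.* 2) ≈s -s (F ^s suc (n ℕ.* 2))
neg-odd-power F zero    = 𝕊.sym { -s (F *s 1s)} {(-s F) *s 1s} (RingProperties.-‿distribˡ-* 𝕊.ring F 1s)
neg-odd-power F (suc n) = begin
  (-s F) *s ((-s F) *s (-s F) ^s m)    ≈⟨ neg*neg F F ((-s F) ^s m) ⟩
  F *s (F *s (-s F) ^s m)              ≈⟨ 𝕊.*-congˡ {F} {F *s (-s F) ^s m} {F *s (-s (F ^s m))} (𝕊.*-congˡ {F} {(-s F) ^s m} { -s (F ^s m)} (neg-odd-power F n)) ⟩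
  F *s (F *s (-s (F ^s m)))            ≈⟨ 𝕊.*-congˡ {F} { -s (F *s F ^s m)} {F *s (-s (F ^s m))} (RP.-‿distribʳ-* F (F ^s m)) ⟨
  F *s (-s (F *s F ^s m))              ≈⟨ RP.-‿distribʳ-* F (F *s F ^s m) ⟨
  -s (F *s (F *s F ^s m))              ∎
  where
  open 𝕊-Reasoning
  module RP = RingProperties 𝕊.ring
  m = suc (n ℕ.* 2)

neg-square-power : ∀ F n → ((-s F) *s (-s F)) ^s n ≈s F ^s (n ℕ.* 2)
neg-square-power F zero    = 𝕊.refl {1s}
neg-square-power F (suc n) = begin
  ((-s F) *s (-s F)) *s P               ≈⟨ 𝕊.*-assoc (-s F) (-s F) P ⟩
  (-s F) *s ((-s F) *s P)               ≈⟨ neg*neg F F P ⟩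
  F *s (F *s P)                         ≈⟨ 𝕊.*-congˡ {F} {F *s P} {F *s F ^s (n ℕ.* 2)} (𝕊.*-congˡ {F} {P} {F ^s (n ℕ.* 2)} (neg-square-power F n)) ⟩
  F *s (F *s F ^s (n ℕ.* 2))            ∎
  where
  open 𝕊-Reasoning
  P = ((-s F) *s (-s F)) ^s n

suc-square : ∀ n → suc n ℕ.* suc n ≡ n ℕ.* n ℕ.+ suc (n ℕ.* 2)
suc-square = ℕSolver.solve-∀

-- The hypotheses on `V` say V_(n+1) = α q^(a n) V_(n+1) + q^(2n+1) V_n. With the sign (-1)^(n+k)
-- this becomes (1 + α q^(a n)) S_(n+1) = (-q)^(2n+1) S_n for S = `signed`, and 1 + α q^(a n) is the
-- next Pochhammer factor. For φ, a n = 2n + 2; for ψ, a n = 2n + 1.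
module Recurrence
         (A : Ser) (A00 : A 0 0 ≡ + 0) (a : ℕ → ℕ)
         (Aq²ⁿ : ∀ n → A *s ((-s qS) *s (-s qS)) ^s n ≈s -s (αS *s qS ^s a n))
         (V : ℕ → Ser) (V-zero : V 0 ≈s 1s)
         (V-suc-zero : ∀ n N → V (suc n) N 0 ≡ shift (suc (n ℕ.* 2)) (λ M → V n M 0) N)
         (V-suc-suc : ∀ n N k → V (suc n) N (suc k) ≡
           shift (a n) (λ M → V (suc n) M k) N + shift (suc (n ℕ.* 2)) (λ M → V n M (suc k)) N)
  where

  signed : ℕ → Ser
  signed n N k = sgnℕ (n ℕ.+ k) * V n N k

  signed-zero : signed 0 ≈s 1s
  signed-zero zero    zero    = trans (ℤ.*-identityˡ (V 0 0 0)) (V-zero 0 0)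
  signed-zero zero    (suc k) = trans (cong (_*_ (sgnℕ (suc k))) (V-zero 0 (suc k))) (ℤ.*-zeroʳ (sgnℕ (suc k)))
  signed-zero (suc N) k       = trans (cong (_*_ (sgnℕ k)) (V-zero (suc N) k)) (ℤ.*-zeroʳ (sgnℕ k))

  private
    signed-suc : ∀ n N k → signed (suc n) N k + shift 1 (λ j → shift (a n) (λ M → signed (suc n) M j) N) k
                           ≡ - shift (suc (n ℕ.* 2)) (λ M → signed n M k) N
    signed-suc n N zero = begin
      sgnℕ (suc n ℕ.+ 0) * V (suc n) N 0 + + 0
        ≡⟨ ℤ.+-identityʳ _ ⟩
      sgnℕ (suc n ℕ.+ 0) * V (suc n) N 0
        ≡⟨ trans (sgnℕ-suc (n ℕ.+ 0) (V (suc n) N 0)) (cong (λ v → - (sgnℕ (n ℕ.+ 0) * v)) (V-suc-zero n N)) ⟩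
      - (sgnℕ (n ℕ.+ 0) * shift (suc (n ℕ.* 2)) (λ M → V n M 0) N)
        ≡⟨ cong (-_) (shift-* (suc (n ℕ.* 2)) (sgnℕ (n ℕ.+ 0)) (λ M → V n M 0) N) ⟨
      - shift (suc (n ℕ.* 2)) (λ M → signed n M 0) N ∎
      where open ≡-Reasoning
    signed-suc n N (suc k) rewrite ℕ.+-suc n k = begin
      sgnℕ (suc (suc m)) * V (suc n) N (suc k) + shift (a n) (λ M → s * V (suc n) M k) N
        ≡⟨ cong₂ _+_ (trans (sgnℕ-suc (suc m) (V (suc n) N (suc k))) (cong (λ v → - (s * v)) (V-suc-suc n N k)))
                     (shift-* (a n) s (λ M → V (suc n) M k) N) ⟩
      - (s * (x + y)) + s * x
        ≡⟨ cong (_+ s * x) (trans (cong (-_) (ℤ.*-distribˡ-+ s x y)) (ℤ.neg-distrib-+ (s * x) (s * y))) ⟩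
      (- (s * x) + - (s * y)) + s * x
        ≡⟨ cong (_+ s * x) (ℤ.+-comm (- (s * x)) (- (s * y))) ⟩
      (- (s * y) + - (s * x)) + s * x
        ≡⟨ trans (ℤ.+-assoc (- (s * y)) (- (s * x)) (s * x)) (cong (_+_ (- (s * y))) (ℤ.+-inverseˡ (s * x))) ⟩
      - (s * y) + + 0
        ≡⟨ ℤ.+-identityʳ (- (s * y)) ⟩
      - (s * y)
        ≡⟨ cong (-_) (shift-* (suc (n ℕ.* 2)) s (λ M → V n M (suc k)) N) ⟨
      - shift (suc (n ℕ.* 2)) (λ M → s * V n M (suc k)) N ∎
      where
      open ≡-Reasoning
      m = n ℕ.+ k
      s = sgnℕ (suc m)
      x = shift (a n) (λ M → V (suc n) M k) N
      y = shift (suc (n ℕ.* 2)) (λ M → V n M (suc k)) N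

    B = (-s qS) *s (-s qS)
    Q = -s qS

    factor : ∀ n → (1s -s A *s B ^s n) *s signed (suc n) ≈s Q ^s suc (n ℕ.* 2) *s signed n
    factor n N k = begin
      ((1s -s A *s B ^s n) *s signed (suc n)) N k
        ≡⟨ neg-times (signed (suc n)) (Aq²ⁿ n) N k ⟩
      signed (suc n) N k + ((αS *s qS ^s a n) *s signed (suc n)) N k
        ≡⟨ cong (_+_ (signed (suc n) N k)) (trans (𝕊.*-assoc αS (qS ^s a n) (signed (suc n)) N k)
             (trans (αS* (qS ^s a n *s signed (suc n)) N k)
               (shift-cong 1 (λ j → qS^* (a n) (signed (suc n)) N j) k))) ⟩
      signed (suc n) N k + shift 1 (λ j → shift (a n) (λ M → signed (suc n) M j) N) k
        ≡⟨ signed-suc n N k ⟩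
      - shift m (λ M → signed n M k) N
        ≡⟨ cong (-_) (qS^* m (signed n) N k) ⟨
      - (qS ^s m *s signed n) N k
        ≡⟨ RingProperties.-‿distribˡ-* 𝕊.ring (qS ^s m) (signed n) N k ⟩
      ((-s (qS ^s m)) *s signed n) N k
        ≡⟨ 𝕊.*-congʳ {signed n} {Q ^s m} { -s (qS ^s m)} (neg-odd-power qS n) N k ⟨
      (Q ^s m *s signed n) N k ∎
      where
      open ≡-Reasoning
      m = suc (n ℕ.* 2)

    -- Each use of `factor` trades one Pochhammer factor for an odd power of -q; the exponents 1, 3,
    -- ..., 2n - 1 add up to n^2.
    poch-signed : ∀ n → poch A B n *s signed n ≈s Q ^s (n ℕ.* n)
    poch-signed zero    = 𝕊.trans {1s *s signed 0} {signed 0} {1s} (𝕊.*-identityˡ (signed 0)) signed-zero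
    poch-signed (suc n) = begin
      (poch A B n *s (1s -s A *s B ^s n)) *s signed (suc n)
        ≈⟨ 𝕊.*-assoc (poch A B n) (1s -s A *s B ^s n) (signed (suc n)) ⟩
      poch A B n *s ((1s -s A *s B ^s n) *s signed (suc n))
        ≈⟨ 𝕊.*-congˡ {poch A B n} {(1s -s A *s B ^s n) *s signed (suc n)} {Q ^s m *s signed n} (factor n) ⟩
      poch A B n *s (Q ^s m *s signed n)
        ≈⟨ 𝕊.*-congˡ {poch A B n} {Q ^s m *s signed n} {signed n *s Q ^s m} (𝕊.*-comm (Q ^s m) (signed n)) ⟩
      poch A B n *s (signed n *s Q ^s m)
        ≈⟨ 𝕊.*-assoc (poch A B n) (signed n) (Q ^s m) ⟨
      (poch A B n *s signed n) *s Q ^s m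
        ≈⟨ 𝕊.*-congʳ {Q ^s m} {poch A B n *s signed n} {Q ^s (n ℕ.* n)} (poch-signed n) ⟩
      Q ^s (n ℕ.* n) *s Q ^s m
        ≈⟨ ^s-+ Q (n ℕ.* n) m ⟨
      Q ^s (n ℕ.* n ℕ.+ m)
        ≡⟨ cong (Q ^s_) (suc-square n) ⟨
      Q ^s (suc n ℕ.* suc n) ∎
      where
      open 𝕊-Reasoning
      m = suc (n ℕ.* 2)

  signed-quotient : ∀ n → signed n ≈s Q ^s (n ℕ.* n) *s inv (poch A B n)
  signed-quotient n = divide {poch A B n} {inv (poch A B n)} {signed n} {Q ^s (n ℕ.* n)}
    (poch-inverse A B A00 n) (poch-signed n)

-- Partitions as chains of parts

ΣL : {A : Set} → List A → (A → ℤ) → ℤ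
ΣL xs f = foldr _+_ (+ 0) (map f xs)

module _ {A : Set} where

  ΣL-cong : ∀ (xs : List A) {f g : A → ℤ} → (∀ x → f x ≡ g x) → ΣL xs f ≡ ΣL xs g
  ΣL-cong []       e = refl
  ΣL-cong (x ∷ xs) e = cong₂ _+_ (e x) (ΣL-cong xs e)

  ΣL-zero : ∀ (xs : List A) → ΣL xs (λ _ → + 0) ≡ + 0
  ΣL-zero []       = refl
  ΣL-zero (x ∷ xs) = trans (ℤ.+-identityˡ _) (ΣL-zero xs)

  ΣL-* : ∀ (xs : List A) s f → ΣL xs (λ x → s * f x) ≡ s * ΣL xs f
  ΣL-* []       s f = sym (ℤ.*-zeroʳ s)
  ΣL-* (x ∷ xs) s f = trans (cong (_+_ (s * f x)) (ΣL-* xs s f)) (sym (ℤ.*-distribˡ-+ s (f x) (ΣL xs f)))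

  ΣL-++ : ∀ (xs ys : List A) f → ΣL (xs ++ ys) f ≡ ΣL xs f + ΣL ys f
  ΣL-++ []       ys f = sym (ℤ.+-identityˡ _)
  ΣL-++ (x ∷ xs) ys f = trans (cong (_+_ (f x)) (ΣL-++ xs ys f)) (sym (ℤ.+-assoc (f x) (ΣL xs f) (ΣL ys f)))

  ΣL-shift : ∀ (xs : List A) a (f : A → ℕ → ℤ) N →
    ΣL xs (λ x → shift a (f x) N) ≡ shift a (λ M → ΣL xs (λ x → f x M)) N
  ΣL-shift xs zero    f N       = refl
  ΣL-shift xs (suc a) f zero    = ΣL-zero xs
  ΣL-shift xs (suc a) f (suc N) = ΣL-shift xs a f N

ΣL-map : ∀ {A B : Set} (g : A → B) xs f → ΣL (map g xs) f ≡ ΣL xs (f ∘ g)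
ΣL-map g xs f = cong (foldr _+_ (+ 0)) (sym (List.map-∘ xs))

ΣL-concatMap : ∀ {A B : Set} (g : A → List B) xs f → ΣL (concatMap g xs) f ≡ ΣL xs (λ x → ΣL (g x) f)
ΣL-concatMap g []       f = refl
ΣL-concatMap g (x ∷ xs) f = trans (ΣL-++ (g x) (concatMap g xs) f) (cong (_+_ (ΣL (g x) f)) (ΣL-concatMap g xs f))

ΣL-lists-suc : ∀ n b f → ΣL (lists (suc n) b) f ≡ Σ< b (λ y → ΣL (lists n b) (λ l → f (suc y ∷ l)))
ΣL-lists-suc n b f = begin
  ΣL (lists (suc n) b) f
    ≡⟨ ΣL-concatMap (λ x → map (x ∷_) (lists n b)) (map suc (upTo b)) f ⟩
  ΣL (map suc (upTo b)) (λ x → ΣL (map (x ∷_) (lists n b)) f)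
    ≡⟨ ΣL-map suc (upTo b) (λ x → ΣL (map (x ∷_) (lists n b)) f) ⟩
  ΣL (upTo b) (λ y → ΣL (map (suc y ∷_) (lists n b)) f)
    ≡⟨ foldr-upTo b (λ y → ΣL (map (suc y ∷_) (lists n b)) f) ⟩
  Σ< b (λ y → ΣL (map (suc y ∷_) (lists n b)) f)
    ≡⟨ Σ<-cong b (λ y _ → ΣL-map (suc y ∷_) (lists n b) f) ⟩
  Σ< b (λ y → ΣL (lists n b) (λ l → f (suc y ∷ l))) ∎
  where open ≡-Reasoning

-- Signs and exponents involve the length, which is constant on `lists n b`; the premise may use it.
ΣL-lists-cong : ∀ n b {f g : List ℕ → ℤ} → (∀ l → length l ≡ n → f l ≡ g l) →
  ΣL (lists n b) f ≡ ΣL (lists n b) g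
ΣL-lists-cong zero    b         e = cong (_+ + 0) (e [] refl)
ΣL-lists-cong (suc n) b {f} {g} e = begin
  ΣL (lists (suc n) b) f                                ≡⟨ ΣL-lists-suc n b f ⟩
  Σ< b (λ y → ΣL (lists n b) (λ l → f (suc y ∷ l)))     ≡⟨ Σ<-cong b (λ y _ → ΣL-lists-cong n b (λ l ll → e (suc y ∷ l) (cong suc ll))) ⟩
  Σ< b (λ y → ΣL (lists n b) (λ l → g (suc y ∷ l)))     ≡⟨ ΣL-lists-suc n b g ⟨
  ΣL (lists (suc n) b) g                                ∎
  where open ≡-Reasoning

[_] : Bool → ℤ
[ p ] = if p then + 1 else + 0

-- A part x put in front multiplies by q^x: the test on the sum becomes a shift of the indicator
-- sequence.
shift-sum : ∀ p x s M → [ p ∧ does (x ℕ.+ s ℕ.≟ M) ] ≡ shift x (λ M′ → [ p ∧ does (s ℕ.≟ M′) ]) M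
shift-sum p zero    s M       = refl
shift-sum p (suc x) s zero    = cong [_] (Bool.∧-zeroʳ p)
shift-sum p (suc x) s (suc M) = shift-sum p x s M

-- All three classes can be described locally, by tests on the first part, on consecutive parts and
-- on the last part. One recursion over lists then counts them all, including OC, whose definition
-- is a global membership condition.
module Chains
  {First End : ℕ → Set} (first? : ∀ x → Dec (First x)) (end? : ∀ x → Dec (End x))
  {Step : ℕ → ℕ → Set} (step? : ∀ x y → Dec (Step x y))
  where

  Accept : ℕ → List ℕ → Set
  Accept x []      = End x
  Accept x (y ∷ l) = Step x y × Accept y l

  accept? : ∀ x l → Dec (Accept x l)
  accept? x []      = end? x
  accept? x (y ∷ l) = step? x y ×-dec accept? y l

  count : ℕ → ℕ → ℕ → ℕ → ℤ
  count b n x M = ΣL (lists n b) (λ l → [ does (accept? x l) ∧ does (sum l ℕ.≟ M) ])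

  count-suc : ∀ b n x M → count b (suc n) x M ≡
    Σ< b (λ y → if does (step? x (suc y)) then shift (suc y) (count b n (suc y)) M else + 0)
  count-suc b n x M = trans (ΣL-lists-suc n b _) (Σ<-cong b (λ y _ → term y))
    where
    term : ∀ y → ΣL (lists n b) (λ l → [ (does (step? x (suc y)) ∧ does (accept? (suc y) l)) ∧ does (suc y ℕ.+ sum l ℕ.≟ M) ])
               ≡ (if does (step? x (suc y)) then shift (suc y) (count b n (suc y)) M else + 0)
    term y with does (step? x (suc y))
    ... | false = ΣL-zero (lists n b)
    ... | true  = trans (ΣL-cong (lists n b) (λ l → shift-sum (does (accept? (suc y) l)) (suc y) (sum l) M))
                        (ΣL-shift (lists n b) (suc y) (λ l M′ → [ does (accept? (suc y) l) ∧ does (sum l ℕ.≟ M′) ]) M)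

  module _ {S : List ℕ → Set} (S? : ∀ l → Dec (S l)) (¬S[] : ¬ S [])
           (S-cons : ∀ x l → S (suc x ∷ l) ⇔ (First (suc x) × Accept (suc x) l))
           (sg ex : ℕ → ℕ → ℤ) (sgL exL : List ℕ → ℤ)
           (sgL-cons : ∀ x l → sgL (x ∷ l) ≡ sg x (length l))
           (exL-cons : ∀ x l → exL (x ∷ l) ≡ ex x (length l))
    where

    -- Sign and exponent depend only on the first part and on the number n of parts after it, so
    -- they leave the sum over the remaining parts. The empty list is discarded by `¬S[]`.
    genSer-by-head : ∀ N k → genSer S? sgL exL N k ≡
      Σ< N (λ n → Σ< N (λ y →
        if does (first? (suc y)) ∧ does (ex (suc y) n ℤ.≟ + k)
        then sg (suc y) n * shift (suc y) (count N n (suc y)) N else + 0))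
    genSer-by-head N k = begin
      ΣL (candidates N) w
        ≡⟨ ΣL-concatMap (λ n → lists n N) (upTo (suc N)) w ⟩
      ΣL (upTo (suc N)) (λ n → ΣL (lists n N) w)
        ≡⟨ foldr-upTo (suc N) (λ n → ΣL (lists n N) w) ⟩
      (w [] + + 0) + Σ< N (λ n → ΣL (lists (suc n) N) w)
        ≡⟨ cong₂ _+_ (cong (_+ + 0) w[]) (Σ<-cong N (λ n _ → trans (ΣL-lists-suc n N w) (Σ<-cong N (λ y _ → head n y)))) ⟩
      + 0 + target
        ≡⟨ ℤ.+-identityˡ target ⟩
      target ∎
      where
      open ≡-Reasoning

      target = Σ< N (λ n → Σ< N (λ y →
        if does (first? (suc y)) ∧ does (ex (suc y) n ℤ.≟ + k)
        then sg (suc y) n * shift (suc y) (count N n (suc y)) N else + 0))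

      w : List ℕ → ℤ
      w l = if does (S? l) ∧ does (sum l ℕ.≟ N) ∧ does (exL l ℤ.≟ + k) then sgL l else + 0

      w[] : w [] ≡ + 0
      w[] = cong (λ p → if p ∧ does (0 ℕ.≟ N) ∧ does (exL [] ℤ.≟ + k) then sgL [] else + 0) (dec-false (S? []) ¬S[])

      rearrange : ∀ a b c d s → (if (a ∧ b) ∧ c ∧ d then s else + 0) ≡ (if a ∧ d then s * [ b ∧ c ] else + 0)
      rearrange false b     c     d     s = refl
      rearrange true  false c     false s = refl
      rearrange true  false c     true  s = sym (ℤ.*-zeroʳ s)
      rearrange true  true  false false s = refl
      rearrange true  true  false true  s = sym (ℤ.*-zeroʳ s)
      rearrange true  true  true  false s = refl
      rearrange true  true  true  true  s = sym (ℤ.*-identityʳ s)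

      head : ∀ n y → ΣL (lists n N) (λ l → w (suc y ∷ l)) ≡
        (if does (first? (suc y)) ∧ does (ex (suc y) n ℤ.≟ + k)
         then sg (suc y) n * shift (suc y) (count N n (suc y)) N else + 0)
      head n y = trans (ΣL-lists-cong n N term) collect
        where
        p = does (first? (suc y)) ∧ does (ex (suc y) n ℤ.≟ + k)

        v : List ℕ → ℕ → ℤ
        v l M = [ does (accept? (suc y) l) ∧ does (sum l ℕ.≟ M) ]

        term : ∀ l → length l ≡ n → w (suc y ∷ l) ≡ (if p then sg (suc y) n * shift (suc y) (v l) N else + 0)
        term l refl
          rewrite sgL-cons (suc y) l | exL-cons (suc y) l
                | does-⇔ (S-cons y l) (S? (suc y ∷ l)) (first? (suc y) ×-dec accept? (suc y) l)
          = trans (rearrange (does (first? (suc y))) (does (accept? (suc y) l)) _ _ (sg (suc y) (length l)))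
              (cong (λ c → if p then sg (suc y) (length l) * c else + 0)
                (shift-sum (does (accept? (suc y) l)) (suc y) (sum l) N))

        collect : ΣL (lists n N) (λ l → if p then sg (suc y) n * shift (suc y) (v l) N else + 0)
          ≡ (if p then sg (suc y) n * shift (suc y) (count N n (suc y)) N else + 0)
        collect with p
        ... | false = ΣL-zero (lists n N)
        ... | true  = trans (ΣL-* (lists n N) (sg (suc y) n) (λ l → shift (suc y) (v l) N))
                            (cong (_*_ (sg (suc y) n)) (ΣL-shift (lists n N) (suc y) v N))

-- The series f

-- R l m N is the number of partitions of N into exactly l parts, all ≤ m.
R : ℕ → ℕ → ℕ → ℤ
R zero    m       N = δ₀ N
R (suc l) zero    N = + 0
R (suc l) (suc m) N = R (suc l) m N + shift (suc m) (R l (suc m)) N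

R-unroll : ∀ l m N → R (suc l) m N ≡ Σ< m (λ y → shift (suc y) (R l (suc y)) N)
R-unroll l zero    N = refl
R-unroll l (suc m) N = trans (cong (_+ shift (suc m) (R l (suc m)) N) (R-unroll l m N))
  (sym (Σ<-snoc m (λ y → shift (suc y) (R l (suc y)) N)))

R-small : ∀ l m {N} → N < l → R l m N ≡ + 0
R-small (suc l) zero    _ = refl
R-small (suc l) (suc m) {N} N<1+l = cong₂ _+_ (R-small (suc l) m N<1+l)
  (shift-zero≤ (suc m) N (λ M mM≤N → R-small l (suc m)
    (ℕ.≤-trans (s≤s (ℕ.m≤n+m M m)) (ℕ.≤-trans mM≤N (ℕ.≤-pred N<1+l)))))

-- The coefficients of 1/(-q;q)_m.
P : ℕ → ℕ → ℤ
P m N = Σ< (suc N) (λ l → sgnℕ l * R l m N)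

P-truncate : ∀ m {N L} → N < L → Σ< L (λ l → sgnℕ l * R l m N) ≡ P m N
P-truncate m N<L = Σ<-pad N<L (λ l N<l → trans (cong (_*_ (sgnℕ l)) (R-small l m N<l)) (ℤ.*-zeroʳ (sgnℕ l)))

-- A shift by at least one consults only coefficients below N, so N lengths suffice where `P m N`
-- takes N + 1.
shift-P : ∀ a m N → Σ< N (λ l → sgnℕ l * shift (suc a) (R l m) N) ≡ shift (suc a) (P m) N
shift-P a m N = begin
  Σ< N (λ l → sgnℕ l * shift (suc a) (R l m) N)
    ≡⟨ Σ<-cong N (λ l _ → shift-* (suc a) (sgnℕ l) (R l m) N) ⟨
  Σ< N (λ l → shift (suc a) (λ M → sgnℕ l * R l m M) N)
    ≡⟨ shift-Σ< (suc a) N (λ l M → sgnℕ l * R l m M) N ⟨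
  shift (suc a) (λ M → Σ< N (λ l → sgnℕ l * R l m M)) N
    ≡⟨ shift-cong≤ (suc a) N (λ M aM≤N → P-truncate m (ℕ.≤-trans (s≤s (ℕ.m≤n+m M a)) aM≤N)) ⟩
  shift (suc a) (P m) N ∎
  where open ≡-Reasoning

-- A further part m + 1 raises the number of parts by one and flips the sign. Thus the recursion of
-- `R` becomes division by 1 + q^(m+1).
P-suc : ∀ m N → P (suc m) N + shift (suc m) (P (suc m)) N ≡ P m N
P-suc m N = begin
  (+ 1 * δ₀ N + Σ< N (λ l → sgnℕ (suc l) * (R (suc l) m N + s l))) + t
    ≡⟨ cong (λ x → (+ 1 * δ₀ N + x) + t) (trans
         (Σ<-cong N (λ l _ → ℤ.*-distribˡ-+ (sgnℕ (suc l)) (R (suc l) m N) (s l)))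
         (Σ<-+ N (λ l → sgnℕ (suc l) * R (suc l) m N) (λ l → sgnℕ (suc l) * s l))) ⟩
  (+ 1 * δ₀ N + (r + Σ< N (λ l → sgnℕ (suc l) * s l))) + t
    ≡⟨ cong (λ x → (+ 1 * δ₀ N + (r + x)) + t) negated ⟩
  (+ 1 * δ₀ N + (r + - t)) + t
    ≡⟨ cong (_+ t) (ℤ.+-assoc (+ 1 * δ₀ N) r (- t)) ⟨
  (P m N + - t) + t
    ≡⟨ ℤ.+-assoc (P m N) (- t) t ⟩
  P m N + (- t + t)
    ≡⟨ cong (_+_ (P m N)) (ℤ.+-inverseˡ t) ⟩
  P m N + + 0
    ≡⟨ ℤ.+-identityʳ (P m N) ⟩
  P m N ∎
  where
  open ≡-Reasoning
  s : ℕ → ℤ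
  s l = shift (suc m) (R l (suc m)) N
  r = Σ< N (λ l → sgnℕ (suc l) * R (suc l) m N)
  t = shift (suc m) (P (suc m)) N

  negated : Σ< N (λ l → sgnℕ (suc l) * s l) ≡ - t
  negated = begin
    Σ< N (λ l → sgnℕ (suc l) * s l)           ≡⟨ Σ<-cong N (λ l _ → ℤ.*-assoc (- + 1) (sgnℕ l) (s l)) ⟩
    Σ< N (λ l → (- + 1) * (sgnℕ l * s l))     ≡⟨ Σ<-* N (- + 1) (λ l → sgnℕ l * s l) ⟩
    (- + 1) * Σ< N (λ l → sgnℕ l * s l)       ≡⟨ cong (_*_ (- + 1)) (shift-P m (suc m) N) ⟩
    (- + 1) * t                               ≡⟨ ℤ.-1*i≡-i t ⟩
    - t                                       ∎

Pser : ℕ → Ser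
Pser m N zero    = P m N
Pser m N (suc k) = + 0

G H : ℕ → Ser
G n = inv (poch (-s qS) qS n)
H n = inv (poch (-s (αS *s qS)) qS n)

G-inverse : ∀ n → poch (-s qS) qS n *s G n ≈s 1s
G-inverse n = poch-inverse (-s qS) qS refl n

H-inverse : ∀ n → poch (-s (αS *s qS)) qS n *s H n ≈s 1s
H-inverse n = poch-inverse (-s (αS *s qS)) qS refl n

-qⁿ⁺¹ : ∀ n → (-s qS) *s qS ^s n ≈s -s (qS ^s suc n)
-qⁿ⁺¹ n = 𝕊.sym { -s (qS ^s suc n)} {(-s qS) *s qS ^s n} (RingProperties.-‿distribˡ-* 𝕊.ring qS (qS ^s n))

-αqⁿ⁺¹ : ∀ n → (-s (αS *s qS)) *s qS ^s n ≈s -s (αS *s qS ^s suc n)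
-αqⁿ⁺¹ n = begin
  (-s (αS *s qS)) *s qS ^s n     ≈⟨ RingProperties.-‿distribˡ-* 𝕊.ring (αS *s qS) (qS ^s n) ⟨
  -s ((αS *s qS) *s qS ^s n)     ≈⟨ 𝕊.-‿cong {(αS *s qS) *s qS ^s n} {αS *s qS ^s suc n} (𝕊.*-assoc αS qS (qS ^s n)) ⟩
  -s (αS *s qS ^s suc n)         ∎
  where open 𝕊-Reasoning

G-step : ∀ n → G n ≈s G (suc n) +s qS ^s suc n *s G (suc n)
G-step n = begin
  G n                                              ≈⟨ inverse-step {f} {g} {G n} {G (suc n)} (G-inverse n) (G-inverse (suc n)) ⟩
  g *s G (suc n)                                   ≈⟨ neg-times (G (suc n)) (-qⁿ⁺¹ n) ⟩
  G (suc n) +s qS ^s suc n *s G (suc n)            ∎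
  where
  open 𝕊-Reasoning
  f = poch (-s qS) qS n
  g = 1s -s (-s qS) *s qS ^s n

H-step : ∀ n → H n ≈s H (suc n) +s αS *s (qS ^s suc n *s H (suc n))
H-step n = begin
  H n                                                   ≈⟨ inverse-step {f} {g} {H n} {H (suc n)} (H-inverse n) (H-inverse (suc n)) ⟩
  g *s H (suc n)                                        ≈⟨ neg-times (H (suc n)) (-αqⁿ⁺¹ n) ⟩
  H (suc n) +s (αS *s qS ^s suc n) *s H (suc n)         ≈⟨ 𝕊.+-congˡ {H (suc n)} {(αS *s qS ^s suc n) *s H (suc n)} {αS *s (qS ^s suc n *s H (suc n))}
                                                             (𝕊.*-assoc αS (qS ^s suc n) (H (suc n))) ⟩
  H (suc n) +s αS *s (qS ^s suc n *s H (suc n))         ∎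
  where
  open 𝕊-Reasoning
  f = poch (-s (αS *s qS)) qS n
  g = 1s -s (-s (αS *s qS)) *s qS ^s n

inv-1s : inv 1s ≈s 1s
inv-1s = 𝕊.trans {inv 1s} {1s *s inv 1s} {1s} (𝕊.sym {1s *s inv 1s} {inv 1s} (𝕊.*-identityˡ (inv 1s))) (inv-inverse {1s} refl)

-- `P-suc` strips the factors of (-q;q)_m from the product with `Pser m` one by one until 1 is left;
-- `divide` then identifies `Pser m` with the inverse.
G≈P : ∀ m → G m ≈s Pser m
G≈P m = 𝕊.sym {Pser m} {G m} (begin
  Pser m        ≈⟨ divide {poch (-s qS) qS m} {G m} {Pser m} {1s} (G-inverse m) (go m) ⟩
  1s *s G m     ≈⟨ 𝕊.*-identityˡ (G m) ⟩
  G m           ∎)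
  where
  open 𝕊-Reasoning

  Pser-zero : Pser 0 ≈s 1s
  Pser-zero N (suc k) with N
  ... | zero  = refl
  ... | suc _ = refl
  Pser-zero N zero = trans (cong (_+_ (+ 1 * δ₀ N)) (Σ<-zero N (λ l _ → ℤ.*-zeroʳ (sgnℕ (suc l)))))
    (trans (ℤ.+-identityʳ _) (trans (ℤ.*-identityˡ (δ₀ N)) (δ₀≡1s N)))

  Pser-suc : ∀ m → (1s -s (-s qS) *s qS ^s m) *s Pser (suc m) ≈s Pser m
  Pser-suc m N k = trans (neg-times (Pser (suc m)) (-qⁿ⁺¹ m) N k)
    (trans (cong (_+_ (Pser (suc m) N k)) (qS^* (suc m) (Pser (suc m)) N k)) (coefficient k))
    where
    coefficient : ∀ k → Pser (suc m) N k + shift (suc m) (λ M → Pser (suc m) M k) N ≡ Pser m N k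
    coefficient zero    = P-suc m N
    coefficient (suc k) = trans (ℤ.+-identityˡ _) (shift-zero≤ (suc m) N (λ _ _ → refl))

  go : ∀ m → poch (-s qS) qS m *s Pser m ≈s 1s
  go zero    = 𝕊.trans {1s *s Pser 0} {Pser 0} {1s} (𝕊.*-identityˡ (Pser 0)) Pser-zero
  go (suc m) = begin
    (f *s g) *s Pser (suc m)    ≈⟨ 𝕊.*-assoc f g (Pser (suc m)) ⟩
    f *s (g *s Pser (suc m))    ≈⟨ 𝕊.*-congˡ {f} {g *s Pser (suc m)} {Pser m} (Pser-suc m) ⟩
    f *s Pser m                 ≈⟨ go m ⟩
    1s                          ∎
    where
    f = poch (-s qS) qS m
    g = 1s -s (-s qS) *s qS ^s m

^s-zero : ∀ F → F ^s 0 ≈s 1s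
^s-zero F = 𝕊.refl {1s}

^s-suc : ∀ F n → F ^s suc n ≈s F *s F ^s n
^s-suc F n = 𝕊.refl {F *s F ^s n}

H-zero : H 0 ≈s 1s
H-zero = inv-1s

module Durfee = Telescope.Sums serRing αS qS (qS ^s_) (^s-zero qS) (^s-suc qS) G H G-step H-step H-zero

αq* : ∀ F N k → (αS *s (qS *s F)) N k ≡ shift 1 (λ j → shift 1 (λ M → F M j) N) k
αq* F N k = trans (αS* (qS *s F) N k) (shift-cong 1 (λ j → qS* F N j) k)

constant⇒order : ∀ {F} → F 0 0 ≡ + 0 → F ≈[ 1 ] 0s
constant⇒order e zero    zero    _        = e
constant⇒order e zero    (suc k) (s≤s ())
constant⇒order e (suc N) k       (s≤s ())

-- Each step contributes a factor α; counting these alone already gives order J.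
coeff-order : ∀ r J → Durfee.coeff r J ≈[ J ] 0s
coeff-order r zero    N k ()
coeff-order r (suc J) N k Nk<1+J = *s-order {J} {1} {Durfee.coeff r J} {X} (coeff-order r J)
  (constant⇒order {X} (trans (*s-constant αS Y) (ℤ.*-zeroˡ (Y 0 0)))) N k
  (subst (N ℕ.+ k <_) (ℕ.+-comm 1 J) Nk<1+J)
  where
  Y = qS ^s suc J *s qS ^s suc (J ℕ.+ r)
  X = αS *s Y

u-order : ∀ r J → Durfee.u r J ≈[ J ] 0s
u-order r J N k Nk<J = *s-order {J} {0} {Durfee.coeff r J} {H J *s G (J ℕ.+ r)} (coeff-order r J)
  (λ _ _ ()) N k (subst (N ℕ.+ k <_) (sym (ℕ.+-identityʳ J)) Nk<J)

-- Below total degree J the remainder vanishes and `telescope` reads B_r = G_r - αq B_(r+1). Since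
-- G_r is free of α, its α^0 part is G_r, and the coefficient of α^(k+1) is -q times that of α^k in
-- B_(r+1). After k steps this leaves (-q)^k G_(r+k).
B-coefficient : ∀ k r J N → N ℕ.+ k < J → Durfee.B r J N k ≡ sgnℕ k * shift k (P (r ℕ.+ k)) N
B-coefficient k r J N Nk<J = extract k Nk<J
  where
  open ≡-Reasoning
  B = Durfee.B

  balance : ∀ k → N ℕ.+ k < J → B r J N k + shift 1 (λ j → shift 1 (λ M → B (suc r) J M j) N) k ≡ Pser r N k
  balance k Nk<J = begin
    B r J N k + shift 1 (λ j → shift 1 (λ M → B (suc r) J M j) N) k
      ≡⟨ cong₂ _+_ (trans (cong (_+_ (B r J N k)) (u-order r J N k Nk<J)) (ℤ.+-identityʳ (B r J N k)))
                   (αq* (B (suc r) J) N k) ⟨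
    (B r J N k + Durfee.u r J N k) + (αS *s (qS *s B (suc r) J)) N k
      ≡⟨ Durfee.telescope r J N k ⟩
    G r N k
      ≡⟨ G≈P r N k ⟩
    Pser r N k ∎

  extract : ∀ k → N ℕ.+ k < J → B r J N k ≡ sgnℕ k * shift k (P (r ℕ.+ k)) N
  extract zero Nk<J = begin
    B r J N 0                 ≡⟨ ℤ.+-identityʳ (B r J N 0) ⟨
    B r J N 0 + + 0           ≡⟨ balance 0 Nk<J ⟩
    P r N                     ≡⟨ cong (λ m → P m N) (ℕ.+-identityʳ r) ⟨
    P (r ℕ.+ 0) N             ≡⟨ ℤ.*-identityˡ _ ⟨
    + 1 * P (r ℕ.+ 0) N       ∎
  extract (suc k) Nk<J = begin
    B r J N (suc k)
      ≡⟨ RingProperties.+-inverseˡ-unique ℤ.+-*-ring (B r J N (suc k)) _ (balance (suc k) Nk<J) ⟩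
    - shift 1 (λ M → B (suc r) J M k) N
      ≡⟨ cong (-_) (shift-cong≤ 1 N (λ M M<N → B-coefficient k (suc r) J M
           (ℕ.<-trans (ℕ.+-mono-<-≤ M<N (ℕ.n≤1+n k)) Nk<J))) ⟩
    - shift 1 (λ M → sgnℕ k * shift k (P (suc r ℕ.+ k)) M) N
      ≡⟨ cong (-_) (trans (shift-* 1 (sgnℕ k) _ N) (cong (_*_ (sgnℕ k)) (shift-shift 1 k _ N))) ⟩
    - (sgnℕ k * shift (suc k) (P (suc r ℕ.+ k)) N)
      ≡⟨ sgnℕ-suc k _ ⟨
    sgnℕ (suc k) * shift (suc k) (P (suc r ℕ.+ k)) N
      ≡⟨ cong (λ m → sgnℕ (suc k) * shift (suc k) (P m) N) (ℕ.+-suc r k) ⟨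
    sgnℕ (suc k) * shift (suc k) (P (r ℕ.+ suc k)) N ∎

B≡Σ< : ∀ r J N k → Durfee.B r J N k ≡ Σ< J (λ j → Durfee.b r j N k)
B≡Σ< r zero    N k = refl
B≡Σ< r (suc J) N k = trans (cong (_+ Durfee.b r J N k) (B≡Σ< r J N k)) (sym (Σ<-snoc J (λ j → Durfee.b r j N k)))

fTerm : ℕ → Ser
fTerm n = qS ^s (n ℕ.* n ∸ n) *s (αS *s qS) ^s n *s inv (poch (-s qS) qS n *s poch (-s (αS *s qS)) qS n)

fTerm-factored : ∀ n → fTerm n ≈s qS ^s (n ℕ.* n ∸ n) *s (αS *s qS) ^s n *s (H n *s G n)
fTerm-factored n = 𝕊.*-congˡ {qS ^s (n ℕ.* n ∸ n) *s (αS *s qS) ^s n} {inv (f *s g)} {H n *s G n} (begin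
  inv (f *s g)      ≈⟨ inverse-* {f} {g} {inv (f *s g)} {G n} {H n} (G-inverse n) (H-inverse n)
                         (inv-inverse {f *s g} (trans (*s-constant f g)
                           (cong₂ _*_ (poch-constant { -s qS} qS refl n) (poch-constant { -s (αS *s qS)} qS refl n)))) ⟩
  G n *s H n        ≈⟨ 𝕊.*-comm (G n) (H n) ⟩
  H n *s G n        ∎)
  where
  open 𝕊-Reasoning
  f = poch (-s qS) qS n
  g = poch (-s (αS *s qS)) qS n

fTerm-zero : fTerm 0 ≈s 1s
fTerm-zero = begin
  fTerm 0                       ≈⟨ fTerm-factored 0 ⟩
  1s *s 1s *s (H 0 *s G 0)      ≈⟨ 𝕊.*-cong {1s *s 1s} {1s} {H 0 *s G 0} {1s *s 1s} (𝕊.*-identityˡ 1s)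
                                     (𝕊.*-cong {H 0} {1s} {G 0} {1s} inv-1s inv-1s) ⟩
  1s *s (1s *s 1s)              ≈⟨ 𝕊.*-identityˡ (1s *s 1s) ⟩
  1s *s 1s                      ≈⟨ 𝕊.*-identityˡ 1s ⟩
  1s                            ∎
  where open 𝕊-Reasoning

fTerm-suc : ∀ j → fTerm (suc j) ≈s αS *s (qS *s Durfee.b 1 j)
fTerm-suc j = begin
  fTerm (suc j)
    ≈⟨ fTerm-factored (suc j) ⟩
  qS ^s (suc j ℕ.* suc j ∸ suc j) *s (αS *s qS) ^s suc j *s (H (suc j) *s G (suc j))
    ≡⟨ cong₂ (λ e m → qS ^s e *s (αS *s qS) ^s suc j *s (H (suc j) *s G m)) (ℕ.m+n∸m≡n (suc j) (j ℕ.* suc j)) (ℕ.+-comm 1 j) ⟩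
  qS ^s (j ℕ.* suc j) *s (αS *s qS) ^s suc j *s (H (suc j) *s G (j ℕ.+ 1))
    ≈⟨ 𝕊.*-congʳ {hg} {qS ^s (j ℕ.* suc j) *s (αS *s qS) ^s suc j} {αS *s (qS *s c)}
         (Durfee.coeff-closed ((αS *s qS) ^s_) (^s-zero (αS *s qS)) (^s-suc (αS *s qS)) j) ⟩
  (αS *s (qS *s c)) *s hg
    ≈⟨ 𝕊.*-assoc αS (qS *s c) hg ⟩
  αS *s ((qS *s c) *s hg)
    ≈⟨ 𝕊.*-congˡ {αS} {(qS *s c) *s hg} {qS *s (c *s hg)} (𝕊.*-assoc qS c hg) ⟩
  αS *s (qS *s Durfee.b 1 j) ∎
  where
  open 𝕊-Reasoning
  c = Durfee.coeff 1 j
  hg = H (suc j) *s G (j ℕ.+ 1)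

largestPartSeries : Ser
largestPartSeries N zero    = + 0
largestPartSeries N (suc k) = sgnℕ k * shift (suc k) (P (suc k)) N

fS≈ : fS (αS *s qS) qS ≈s 1s +s largestPartSeries
fS≈ N k = begin
  fS (αS *s qS) qS N k
    ≡⟨ Σ≤≡Σ< (N ℕ.+ k) (λ n → fTerm n N k) ⟩
  fTerm 0 N k + Σ< (N ℕ.+ k) (λ j → fTerm (suc j) N k)
    ≡⟨ cong₂ _+_ (fTerm-zero N k) (Σ<-cong (N ℕ.+ k) (λ j _ → trans (fTerm-suc j N k) (αq* (Durfee.b 1 j) N k))) ⟩
  1s N k + Σ< (N ℕ.+ k) (λ j → shift 1 (λ i → shift 1 (λ M → Durfee.b 1 j M i) N) k)
    ≡⟨ cong (_+_ (1s N k)) (coefficient k) ⟩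
  1s N k + largestPartSeries N k ∎
  where
  open ≡-Reasoning
  coefficient : ∀ k → Σ< (N ℕ.+ k) (λ j → shift 1 (λ i → shift 1 (λ M → Durfee.b 1 j M i) N) k) ≡ largestPartSeries N k
  coefficient zero    = Σ<-zero (N ℕ.+ 0) (λ _ _ → refl)
  coefficient (suc k) = begin
    Σ< J (λ j → shift 1 (λ M → Durfee.b 1 j M k) N)
      ≡⟨ shift-Σ< 1 J (λ j M → Durfee.b 1 j M k) N ⟨
    shift 1 (λ M → Σ< J (λ j → Durfee.b 1 j M k)) N
      -- The prefactor αq lowers both degrees, so the J = N + k + 1 terms kept by `Σ∞` are enough
      -- for degree M + k with M < N.
      ≡⟨ shift-cong≤ 1 N (λ M M<N → trans (sym (B≡Σ< 1 J M k))
           (B-coefficient k 1 J M (ℕ.+-mono-<-≤ M<N (ℕ.n≤1+n k)))) ⟩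
    shift 1 (λ M → sgnℕ k * shift k (P (suc k)) M) N
      ≡⟨ trans (shift-* 1 (sgnℕ k) _ N) (cong (_*_ (sgnℕ k)) (shift-shift 1 k (P (suc k)) N)) ⟩
    sgnℕ k * shift (suc k) (P (suc k)) N ∎
    where J = N ℕ.+ suc k

-- Partitions by largest part

module PartitionChains = Chains (1 ℕ.≤?_) (λ _ → yes tt) (λ x y → 1 ℕ.≤? y ×-dec y ℕ.≤? x)

InP-cons : ∀ x l → InP (suc x ∷ l) ⇔ (1 ≤ suc x × PartitionChains.Accept (suc x) l)
InP-cons x l = mk⇔ (λ { (_ , p ∷ ps , ls) → p , to (suc x) l ps ls })
                   (λ { (p , a) → tt , p ∷ proj₁ (from (suc x) l a) , proj₂ (from (suc x) l a) })
  where
  open PartitionChains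
  to : ∀ x l → All (1 ≤_) l → Linked _≥_ (x ∷ l) → Accept x l
  to x []      []       [-]      = tt
  to x (y ∷ l) (p ∷ ps) (r ∷ ls) = (p , r) , to y l ps ls

  from : ∀ x l → Accept x l → All (1 ≤_) l × Linked _≥_ (x ∷ l)
  from x []      _             = [] , [-]
  from x (y ∷ l) ((p , r) , a) = p ∷ proj₁ (from y l a) , r ∷ proj₂ (from y l a)

-- Parts never exceed an earlier part, so the bound `b` on the list entries has no effect once m ≤
-- b.
partition-count : ∀ {b} n m N → m ≤ b → PartitionChains.count b n m N ≡ R n m N
partition-count {b} zero m N m≤b = trans (ℤ.+-identityʳ _) (0≟≡δ₀ N)
partition-count {b} (suc n) m N m≤b = begin
  count b (suc n) m N
    ≡⟨ count-suc b n m N ⟩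
  Σ< b (λ y → if does (suc y ℕ.≤? m) then shift (suc y) (count b n (suc y)) N else + 0)
    ≡⟨ Σ<-restrict (λ y → shift (suc y) (count b n (suc y)) N) m≤b ⟩
  Σ< m (λ y → shift (suc y) (count b n (suc y)) N)
    ≡⟨ Σ<-cong m (λ y y<m → shift-cong (suc y) (λ M → partition-count n (suc y) M (ℕ.≤-trans y<m m≤b)) N) ⟩
  Σ< m (λ y → shift (suc y) (R n (suc y)) N)
    ≡⟨ R-unroll n m N ⟨
  R (suc n) m N ∎
  where
  open ≡-Reasoning
  open PartitionChains

-- For largest part m + 1 and n further parts the rank is m - n, with sign (-1)^m (-1)^n. The sum
-- over n of the second sign is the alternating sum `P`.
genSer-P : genSer inP? (λ l → sgn (rank l)) (λ l → + largest l) ≈s largestPartSeries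
genSer-P N k = trans (genSer-by-head inP? (λ ()) InP-cons
    (λ x n → sgn (+ x - + suc n)) (λ x n → + x) _ (λ l → + largest l) (λ _ _ → refl) (λ _ _ → refl) N k) (coefficient k)
  where
  open ≡-Reasoning
  open PartitionChains
  coefficient : ∀ k → Σ< N (λ n → Σ< N (λ y → if does (suc y ℕ.≟ k)
    then sgn (+ suc y - + suc n) * shift (suc y) (count N n (suc y)) N else + 0)) ≡ largestPartSeries N k
  coefficient zero    = Σ<-zero N (λ _ _ → Σ<-zero N (λ _ _ → refl))
  coefficient (suc m) = begin
    Σ< N (λ n → Σ< N (λ y → if does (y ℕ.≟ m)
      then sgn (+ suc y - + suc n) * shift (suc y) (count N n (suc y)) N else + 0))
      ≡⟨ Σ<-cong N (λ n _ → Σ<-single N m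
           (λ y → sgn (+ suc y - + suc n) * shift (suc y) (count N n (suc y)) N)
           (λ N≤m → trans (cong (_*_ (sgn (+ suc m - + suc n))) (shift-small (suc m) (count N n (suc m)) (s≤s N≤m)))
                          (ℤ.*-zeroʳ (sgn (+ suc m - + suc n))))) ⟩
    Σ< N (λ n → sgn (+ suc m - + suc n) * shift (suc m) (count N n (suc m)) N)
      ≡⟨ Σ<-cong N (λ n _ → cong₂ _*_ (sign n) (shift-count n)) ⟩
    Σ< N (λ n → sgnℕ m * sgnℕ n * shift (suc m) (R n (suc m)) N)
      ≡⟨ Σ<-cong N (λ n _ → ℤ.*-assoc (sgnℕ m) (sgnℕ n) _) ⟩
    Σ< N (λ n → sgnℕ m * (sgnℕ n * shift (suc m) (R n (suc m)) N))
      ≡⟨ Σ<-* N (sgnℕ m) _ ⟩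
    sgnℕ m * Σ< N (λ n → sgnℕ n * shift (suc m) (R n (suc m)) N)
      ≡⟨ cong (_*_ (sgnℕ m)) (shift-P m (suc m) N) ⟩
    sgnℕ m * shift (suc m) (P (suc m)) N ∎
    where
    sign : ∀ n → sgn (+ suc m - + suc n) ≡ sgnℕ m * sgnℕ n
    sign n = trans (cong sgn (ℤ.[1+m]⊖[1+n]≡m⊖n m n)) (trans (cong sgn (sym (ℤ.m-n≡m⊖n m n))) (sgn-minus m n))

    shift-count : ∀ n → shift (suc m) (count N n (suc m)) N ≡ shift (suc m) (R n (suc m)) N
    shift-count n = shift-cong≤ (suc m) N (λ M mM≤N → partition-count n (suc m) M (ℕ.≤-trans (ℕ.m≤m+n (suc m) M) mM≤N))

-- The series φ

double-odd : ∀ m → Odd (suc (m ℕ.* 2))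
double-odd zero    = refl
double-odd (suc m) = double-odd m

odd⇒double : ∀ y → Odd (suc y) → ∃ λ m → y ≡ m ℕ.* 2
odd⇒double zero          _ = 0 , refl
odd⇒double (suc zero)    ()
odd⇒double (suc (suc y)) p with m , refl ← odd⇒double y p = suc m , refl

half-double : ∀ m → (suc (m ℕ.* 2) ℕ.+ 1) ℕ./ 2 ≡ suc m
half-double m = trans (cong (ℕ._/ 2) (ℕ.+-comm (suc (m ℕ.* 2)) 1)) (ℕ.m*n/n≡m (suc m) 2)

Σ<-odd : ∀ c (f : ℕ → ℤ) → Σ< (c ℕ.* 2) (λ y → if does (odd? (suc y)) then f y else + 0) ≡ Σ< c (λ i → f (i ℕ.* 2))
Σ<-odd zero    f = refl
Σ<-odd (suc c) f = cong (_+_ (f 0)) (trans (ℤ.+-identityˡ _) (Σ<-odd c (f ∘ suc ∘ suc)))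

-- These counts carry no α, so the one-variable ring is used with q as its variable.
module Distinct = OddPascal.Powers Inner.powerSeriesRing (xPow 1) xPow (λ _ → refl) xPow-suc
open Distinct using (D)

D-suc-suc : ∀ n c N → D (suc n) (suc c) N ≡ D (suc n) c N + shift (suc (c ℕ.* 2)) (D n c) N
D-suc-suc n c N = cong (_+_ (D (suc n) c N)) (xPow⊛ (suc (c ℕ.* 2)) (D n c) N)

D-pascal : ∀ n c N → D (suc n) (suc c) N ≡ shift (suc n ℕ.* 2) (D (suc n) c) N + shift (suc (n ℕ.* 2)) (D n c) N
D-pascal n c N = trans (Distinct.pascal n c N)
  (cong₂ _+_ (xPow⊛ (suc n ℕ.* 2) (D (suc n) c) N) (xPow⊛ (suc (n ℕ.* 2)) (D n c) N))

D-unroll : ∀ n c N → D (suc n) c N ≡ Σ< c (λ i → shift (suc (i ℕ.* 2)) (D n i) N)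
D-unroll n zero    N = refl
D-unroll n (suc c) N = trans (D-suc-suc n c N)
  (trans (cong (_+ shift (suc (c ℕ.* 2)) (D n c) N) (D-unroll n c N))
         (sym (Σ<-snoc c (λ i → shift (suc (i ℕ.* 2)) (D n i) N))))

-- There are only c odd numbers below 2c.
D-zero : ∀ n c N → c < n → D n c N ≡ + 0
D-zero (suc n) zero    N _         = refl
D-zero (suc n) (suc c) N (s≤s c<n) = trans (D-suc-suc n c N)
  (cong₂ _+_ (D-zero (suc n) c N (ℕ.m<n⇒m<1+n c<n))
             (shift-zero≤ (suc (c ℕ.* 2)) N (λ M _ → D-zero n c M c<n)))

-- The coefficient of α^k counts the partitions into n distinct odd parts with largest part 2(n + k) - 1.
distinct : ℕ → Ser
distinct zero            = 1s
distinct (suc n) N k = shift (suc ((n ℕ.+ k) ℕ.* 2)) (D n (n ℕ.+ k)) N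

1s-suc : ∀ N k → 1s N (suc k) ≡ + 0
1s-suc zero    k = refl
1s-suc (suc N) k = refl

distinct-suc-zero : ∀ n N → distinct (suc n) N 0 ≡ shift (suc (n ℕ.* 2)) (λ M → distinct n M 0) N
distinct-suc-zero zero    N = shift-cong 1 δ₀≡1s N
distinct-suc-zero (suc n) N rewrite ℕ.+-identityʳ n = shift-cong (suc (suc n ℕ.* 2)) (λ M →
  trans (D-suc-suc n n M) (trans (cong (_+ shift (suc (n ℕ.* 2)) (D n n) M) (D-zero (suc n) n M ℕ.≤-refl))
    (ℤ.+-identityˡ _))) N

-- If 1 is not a part, all n + 1 parts drop by 2 and the exponent of α by one. If 1 is a part, it is
-- removed and the other n parts drop by 2; half and length both fall by one, so the exponent stays.
-- `D-pascal` does this below the largest part.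
distinct-suc-suc : ∀ n N k → distinct (suc n) N (suc k) ≡
  shift (suc n ℕ.* 2) (λ M → distinct (suc n) M k) N + shift (suc (n ℕ.* 2)) (λ M → distinct n M (suc k)) N
distinct-suc-suc zero N k = sym (begin
  shift 2 (shift (suc (k ℕ.* 2)) δ₀) N + shift 1 (λ M → 1s M (suc k)) N
    ≡⟨ cong₂ _+_ (trans (shift-shift 2 (suc (k ℕ.* 2)) δ₀ N) refl)
                 (shift-zero≤ 1 N (λ M _ → 1s-suc M k)) ⟩
  shift (suc (suc k ℕ.* 2)) δ₀ N + + 0
    ≡⟨ ℤ.+-identityʳ _ ⟩
  shift (suc (suc k ℕ.* 2)) δ₀ N ∎)
  where open ≡-Reasoning
distinct-suc-suc (suc n) N k rewrite ℕ.+-suc n k = begin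
  shift e (D (suc n) (suc c)) N
    ≡⟨ shift-cong e (D-pascal n c) N ⟩
  shift e (λ M → shift (suc n ℕ.* 2) (D (suc n) c) M + shift (suc (n ℕ.* 2)) (D n c) M) N
    ≡⟨ shift-+ e (shift (suc n ℕ.* 2) (D (suc n) c)) (shift (suc (n ℕ.* 2)) (D n c)) N ⟩
  shift e (shift (suc n ℕ.* 2) (D (suc n) c)) N + shift e (shift (suc (n ℕ.* 2)) (D n c)) N
    ≡⟨ cong₂ _+_ (reassociate e (suc n ℕ.* 2) (suc (suc n) ℕ.* 2) (suc (c ℕ.* 2)) (D (suc n) c) (exponent₁ c n))
                 (reassociate e (suc (n ℕ.* 2)) (suc (suc n ℕ.* 2)) (suc (c ℕ.* 2)) (D n c) (exponent₂ c n)) ⟩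
  shift (suc (suc n) ℕ.* 2) (shift (suc (c ℕ.* 2)) (D (suc n) c)) N
    + shift (suc (suc n ℕ.* 2)) (shift (suc (c ℕ.* 2)) (D n c)) N ∎
  where
  open ≡-Reasoning
  c = suc (n ℕ.+ k)
  e = suc (suc c ℕ.* 2)

  reassociate : ∀ a b a′ b′ f → a ℕ.+ b ≡ a′ ℕ.+ b′ → shift a (shift b f) N ≡ shift a′ (shift b′ f) N
  reassociate a b a′ b′ f eq = trans (shift-shift a b f N) (trans (cong (λ i → shift i f N) eq) (sym (shift-shift a′ b′ f N)))

  exponent₁ : ∀ c n → suc (suc c ℕ.* 2) ℕ.+ suc n ℕ.* 2 ≡ suc (suc n) ℕ.* 2 ℕ.+ suc (c ℕ.* 2)
  exponent₁ = ℕSolver.solve-∀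

  exponent₂ : ∀ c n → suc (suc c ℕ.* 2) ℕ.+ suc (n ℕ.* 2) ≡ suc (suc n ℕ.* 2) ℕ.+ suc (c ℕ.* 2)
  exponent₂ = ℕSolver.solve-∀

-- This equals -αq^2. It is left unevaluated so as to agree by computation with the Pochhammer
-- argument in `φS` after the substitution.
φA : Ser
φA = -s ((-s (αS *s qS)) *s (-s qS))

φA-power : ∀ n → φA *s ((-s qS) *s (-s qS)) ^s n ≈s -s (αS *s qS ^s (suc n ℕ.* 2))
φA-power n = begin
  φA *s B ^s n
    ≈⟨ 𝕊.*-congˡ {φA} {B ^s n} {q²ⁿ} (neg-square-power qS n) ⟩
  φA *s q²ⁿ
    ≈⟨ RingProperties.-‿distribˡ-* 𝕊.ring ((-s (αS *s qS)) *s (-s qS)) q²ⁿ ⟨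
  -s (((-s (αS *s qS)) *s (-s qS)) *s q²ⁿ)
    ≈⟨ 𝕊.-‿cong {((-s (αS *s qS)) *s (-s qS)) *s q²ⁿ} {αS *s qS ^s (suc n ℕ.* 2)} (begin
        ((-s (αS *s qS)) *s (-s qS)) *s q²ⁿ      ≈⟨ 𝕊.*-assoc (-s (αS *s qS)) (-s qS) q²ⁿ ⟩
        (-s (αS *s qS)) *s ((-s qS) *s q²ⁿ)      ≈⟨ neg*neg (αS *s qS) qS q²ⁿ ⟩
        (αS *s qS) *s (qS *s q²ⁿ)                ≈⟨ 𝕊.*-assoc αS qS (qS *s q²ⁿ) ⟩
        αS *s (qS *s (qS *s q²ⁿ))                ∎) ⟩
  -s (αS *s qS ^s (suc n ℕ.* 2)) ∎
  where
  open 𝕊-Reasoning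
  B = (-s qS) *s (-s qS)
  q²ⁿ = qS ^s (n ℕ.* 2)

module Φ = Recurrence φA refl (λ n → suc n ℕ.* 2) φA-power distinct (𝕊.refl {1s}) distinct-suc-zero distinct-suc-suc

distinctOddSeries : Ser
distinctOddSeries N k = Σ< N (λ n → Φ.signed (suc n) N k)

φS≈ : φS (-s (αS *s qS)) (-s qS) ≈s 1s +s distinctOddSeries
φS≈ N k = begin
  φS (-s (αS *s qS)) (-s qS) N k
    ≡⟨ Σ≤≡Σ< (N ℕ.+ k) (λ n → ((-s qS) ^s (n ℕ.* n) *s inv (poch φA ((-s qS) *s (-s qS)) n)) N k) ⟩
  Σ< (suc (N ℕ.+ k)) (λ n → ((-s qS) ^s (n ℕ.* n) *s inv (poch φA ((-s qS) *s (-s qS)) n)) N k)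
    ≡⟨ Σ<-cong (suc (N ℕ.+ k)) (λ n _ → Φ.signed-quotient n N k) ⟨
  Φ.signed 0 N k + Σ< (N ℕ.+ k) (λ n → Φ.signed (suc n) N k)
    -- For n ≥ N the largest part 2(n + k) + 1 exceeds N, so the range of `Σ∞` shrinks to that of
    -- the list sum.
    ≡⟨ cong₂ _+_ (Φ.signed-zero N k)
                 (Σ<-pad (ℕ.m≤m+n N k) (λ n N≤n → trans (cong (_*_ (sgnℕ (suc n ℕ.+ k)))
                   (shift-small (suc ((n ℕ.+ k) ℕ.* 2)) (D n (n ℕ.+ k)) (s≤s (ℕ.≤-trans N≤n
                     (ℕ.≤-trans (ℕ.m≤m+n n k) (ℕ.m≤m*n (n ℕ.+ k) 2))))))
                   (ℤ.*-zeroʳ (sgnℕ (suc n ℕ.+ k))))) ⟩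
  1s N k + distinctOddSeries N k ∎
  where open ≡-Reasoning

module DistinctOddChains = Chains odd? (λ _ → yes tt) (λ x y → y ℕ.<? x ×-dec odd? y)

odd⇒positive : ∀ x → Odd x → 1 ≤ x
odd⇒positive (suc x) _ = s≤s z≤n

InDO-cons : ∀ x l → InDO (suc x ∷ l) ⇔ (Odd (suc x) × DistinctOddChains.Accept (suc x) l)
InDO-cons x l = mk⇔ (λ { (_ , ls , o ∷ os) → o , to (suc x) l ls os }) from′
  where
  open DistinctOddChains
  to : ∀ x l → Linked _>_ (x ∷ l) → All Odd l → Accept x l
  to x []      [-]      []       = tt
  to x (y ∷ l) (r ∷ ls) (o ∷ os) = (r , o) , to y l ls os

  from : ∀ x l → Accept x l → All (1 ≤_) l × Linked _≥_ (x ∷ l) × Linked _>_ (x ∷ l) × All Odd l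
  from x []      _             = [] , [-] , [-] , []
  from x (y ∷ l) ((r , o) , a) with ps , gs , ls , os ← from y l a =
    odd⇒positive y o ∷ ps , ℕ.<⇒≤ r ∷ gs , r ∷ ls , o ∷ os

  from′ : Odd (suc x) × Accept (suc x) l → InDO (suc x ∷ l)
  from′ (o , a) with ps , gs , ls , os ← from (suc x) l a = (tt , s≤s z≤n ∷ ps , gs) , ls , o ∷ os

if-∧ : ∀ p r (x : ℤ) → (if p ∧ r then x else + 0) ≡ (if p then (if r then x else + 0) else + 0)
if-∧ true  r x = refl
if-∧ false r x = refl

distinctOdd-count : ∀ {b} n c N → c ℕ.* 2 ≤ b → DistinctOddChains.count b n (suc (c ℕ.* 2)) N ≡ D n c N
distinctOdd-count {b} zero c N c≤b = trans (ℤ.+-identityʳ _) (0≟≡δ₀ N)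
distinctOdd-count {b} (suc n) c N c≤b = begin
  count b (suc n) (suc (c ℕ.* 2)) N
    ≡⟨ count-suc b n (suc (c ℕ.* 2)) N ⟩
  Σ< b (λ y → if does (suc y ℕ.≤? c ℕ.* 2) ∧ does (odd? (suc y)) then f y else + 0)
    ≡⟨ Σ<-cong b (λ y _ → if-∧ (does (suc y ℕ.≤? c ℕ.* 2)) (does (odd? (suc y))) (f y)) ⟩
  Σ< b (λ y → if does (suc y ℕ.≤? c ℕ.* 2) then (if does (odd? (suc y)) then f y else + 0) else + 0)
    ≡⟨ Σ<-restrict (λ y → if does (odd? (suc y)) then f y else + 0) c≤b ⟩
  Σ< (c ℕ.* 2) (λ y → if does (odd? (suc y)) then f y else + 0)
    ≡⟨ Σ<-odd c f ⟩
  Σ< c (λ i → f (i ℕ.* 2))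
    ≡⟨ Σ<-cong c (λ i i<c → shift-cong (suc (i ℕ.* 2)) (λ M →
         distinctOdd-count n i M (ℕ.≤-trans (ℕ.*-monoˡ-≤ 2 (ℕ.<⇒≤ i<c)) c≤b)) N) ⟩
  Σ< c (λ i → shift (suc (i ℕ.* 2)) (D n i) N)
    ≡⟨ D-unroll n c N ⟨
  D (suc n) c N ∎
  where
  open ≡-Reasoning
  open DistinctOddChains
  f : ℕ → ℤ
  f y = shift (suc y) (count b n (suc y)) N

-- The variables are neutral because the roles alternate: half the largest part is the minuend for
-- DO and the subtrahend for OC.
half-minus : ∀ m n k → + suc m - + suc n ≡ + k → m ≡ n ℕ.+ k
half-minus m n k e = ℕ.suc-injective (ℤ.+-injective (begin
  + suc m                            ≡⟨ ℤ.+-identityʳ (+ suc m) ⟨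
  + suc m + + 0                      ≡⟨ cong (_+_ (+ suc m)) (ℤ.+-inverseˡ (+ suc n)) ⟨
  + suc m + (- + suc n + + suc n)    ≡⟨ ℤ.+-assoc (+ suc m) (- + suc n) (+ suc n) ⟨
  (+ suc m - + suc n) + + suc n    ≡⟨ cong (_+ + suc n) e ⟩
  + (k ℕ.+ suc n)                    ≡⟨ cong +_ (ℕ.+-comm k (suc n)) ⟩
  + suc (n ℕ.+ k)                    ∎))
  where open ≡-Reasoning

minus-half : ∀ n k → + suc (n ℕ.+ k) - + suc n ≡ + k
minus-half n k = begin
  + suc (n ℕ.+ k) - + suc n      ≡⟨ ℤ.m-n≡m⊖n (suc (n ℕ.+ k)) (suc n) ⟩
  suc (n ℕ.+ k) ℤ.⊖ suc n          ≡⟨ ℤ.⊖-≥ (s≤s (ℕ.m≤m+n n k)) ⟩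
  + (n ℕ.+ k ∸ n)                  ≡⟨ cong +_ (ℕ.m+n∸m≡n n k) ⟩
  + k                              ∎
  where open ≡-Reasoning

-- The number of parts and the exponent of α determine the largest part, so the sum over first parts
-- collapses to the term y = 2(n + k), with sign (-1)^(n+k+1).
genSer-DO : genSer inDO? (λ l → sgnℕ (half l)) (λ l → + half l - + length l) ≈s distinctOddSeries
genSer-DO N k = trans
  (genSer-by-head inDO? (λ { ((() , _) , _) }) InDO-cons
    (λ x n → sgnℕ ((x ℕ.+ 1) ℕ./ 2)) (λ x n → + ((x ℕ.+ 1) ℕ./ 2) - + suc n)
    (λ l → sgnℕ (half l)) (λ l → + half l - + length l) (λ _ _ → refl) (λ _ _ → refl) N k)
  (Σ<-cong N (λ n _ → lengthTerm n))
  where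
  open ≡-Reasoning
  open DistinctOddChains

  T : ℕ → ℕ → ℤ
  T n y = sgnℕ ((suc y ℕ.+ 1) ℕ./ 2) * shift (suc y) (count N n (suc y)) N

  head⇔ : ∀ n y → (Odd (suc y) × + ((suc y ℕ.+ 1) ℕ./ 2) - + suc n ≡ + k) ⇔ (y ≡ (n ℕ.+ k) ℕ.* 2)
  head⇔ n y = mk⇔ to (λ { refl → double-odd (n ℕ.+ k)
                             , trans (cong (λ h → + h - + suc n) (half-double (n ℕ.+ k))) (minus-half n k) })
    where
    to : Odd (suc y) × + ((suc y ℕ.+ 1) ℕ./ 2) - + suc n ≡ + k → y ≡ (n ℕ.+ k) ℕ.* 2
    to (o , e) with m , refl ← odd⇒double y o =
      cong (ℕ._* 2) (half-minus m n k (trans (cong (λ h → + h - + suc n) (sym (half-double m))) e))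

  lengthTerm : ∀ n → Σ< N (λ y → if does (odd? (suc y)) ∧ does (+ ((suc y ℕ.+ 1) ℕ./ 2) - + suc n ℤ.≟ + k) then T n y else + 0)
    ≡ Φ.signed (suc n) N k
  lengthTerm n = begin
    Σ< N (λ y → if does (odd? (suc y)) ∧ does (+ ((suc y ℕ.+ 1) ℕ./ 2) - + suc n ℤ.≟ + k) then T n y else + 0)
      ≡⟨ Σ<-cong N (λ y _ → cong (if_then T n y else + 0) (does-⇔ (head⇔ n y)
           (odd? (suc y) ×-dec (+ ((suc y ℕ.+ 1) ℕ./ 2) - + suc n ℤ.≟ + k)) (y ℕ.≟ c ℕ.* 2))) ⟩
    Σ< N (λ y → if does (y ℕ.≟ c ℕ.* 2) then T n y else + 0)
      ≡⟨ Σ<-single N (c ℕ.* 2) (T n) (λ N≤2c → trans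
           (cong (_*_ (sgnℕ ((suc (c ℕ.* 2) ℕ.+ 1) ℕ./ 2))) (shift-small (suc (c ℕ.* 2)) (count N n (suc (c ℕ.* 2))) (s≤s N≤2c)))
           (ℤ.*-zeroʳ (sgnℕ ((suc (c ℕ.* 2) ℕ.+ 1) ℕ./ 2)))) ⟩
    T n (c ℕ.* 2)
      ≡⟨ cong₂ _*_ (cong sgnℕ (half-double c))
           (shift-cong≤ (suc (c ℕ.* 2)) N (λ M cM≤N → distinctOdd-count n c M
             (ℕ.≤-trans (ℕ.m≤n+m (c ℕ.* 2) 1) (ℕ.≤-trans (ℕ.m≤m+n (suc (c ℕ.* 2)) M) cM≤N)))) ⟩
    Φ.signed (suc n) N k ∎
    where
    c = n ℕ.+ k

-- The series ψ

-- C l n N is the number of partitions of N into l odd parts without gaps whose largest part is 2n - 1.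
C : ℕ → ℕ → ℕ → ℤ
C zero    zero    N = δ₀ N
C zero    (suc n) N = + 0
C (suc l) zero    N = + 0
C (suc l) (suc n) N = shift (suc (n ℕ.* 2)) (λ M → C l n M + C l (suc n) M) N

-- Without gaps, the n numbers 1, 3, ..., 2n - 1 all have to occur.
C-zero : ∀ l n N → l < n → C l n N ≡ + 0
C-zero zero    (suc n) N _         = refl
C-zero (suc l) (suc n) N (s≤s l<n) = shift-zero≤ (suc (n ℕ.* 2)) N (λ M _ →
  cong₂ _+_ (C-zero l n M l<n) (C-zero l (suc n) M (ℕ.m<n⇒m<1+n l<n)))

C-small : ∀ l n {N} → N < l → C l n N ≡ + 0
C-small (suc l) zero        _     = refl
C-small (suc l) (suc n) {N} N<1+l = shift-zero≤ (suc (n ℕ.* 2)) N (λ M nM≤N →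
  let M<l = ℕ.≤-trans (s≤s (ℕ.m≤n+m M (n ℕ.* 2))) (ℕ.≤-trans nM≤N (ℕ.≤-pred N<1+l)) in
  cong₂ _+_ (C-small l n M<l) (C-small l (suc n) M<l))

gapless : ℕ → Ser
gapless n N k = C (n ℕ.+ k) n N

gapless-zero : gapless 0 ≈s 1s
gapless-zero N zero    = δ₀≡1s N
gapless-zero N (suc k) = sym (1s-suc N k)

gapless-suc-zero : ∀ n N → gapless (suc n) N 0 ≡ shift (suc (n ℕ.* 2)) (λ M → gapless n M 0) N
gapless-suc-zero n N = shift-cong (suc (n ℕ.* 2)) (λ M →
  trans (cong (_+_ (C (n ℕ.+ 0) n M)) (C-zero (n ℕ.+ 0) (suc n) M (s≤s (ℕ.≤-reflexive (ℕ.+-identityʳ n)))))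
        (ℤ.+-identityʳ (C (n ℕ.+ 0) n M))) N

-- Removing one copy of the largest part 2n + 1 lowers the exponent of α when another copy remains.
-- Otherwise half and length fall together and the exponent is unchanged.
gapless-suc-suc : ∀ n N k → gapless (suc n) N (suc k) ≡
  shift (suc (n ℕ.* 2)) (λ M → gapless (suc n) M k) N + shift (suc (n ℕ.* 2)) (λ M → gapless n M (suc k)) N
gapless-suc-suc n N k rewrite ℕ.+-suc n k = trans
  (shift-+ (suc (n ℕ.* 2)) (C (suc (n ℕ.+ k)) n) (C (suc (n ℕ.+ k)) (suc n)) N)
  (ℤ.+-comm (shift (suc (n ℕ.* 2)) (C (suc (n ℕ.+ k)) n) N) _)

ψA : Ser
ψA = -s (αS *s qS)

ψA-power : ∀ n → ψA *s ((-s qS) *s (-s qS)) ^s n ≈s -s (αS *s qS ^s suc (n ℕ.* 2))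
ψA-power n = begin
  ψA *s ((-s qS) *s (-s qS)) ^s n    ≈⟨ 𝕊.*-congˡ {ψA} {((-s qS) *s (-s qS)) ^s n} {qS ^s (n ℕ.* 2)} (neg-square-power qS n) ⟩
  ψA *s qS ^s (n ℕ.* 2)              ≈⟨ -αqⁿ⁺¹ (n ℕ.* 2) ⟩
  -s (αS *s qS ^s suc (n ℕ.* 2))     ∎
  where open 𝕊-Reasoning

module Ψ = Recurrence ψA refl (λ n → suc (n ℕ.* 2)) ψA-power gapless gapless-zero gapless-suc-zero gapless-suc-suc

gaplessOddSeries : Ser
gaplessOddSeries N k = Σ< N (λ m → Ψ.signed (suc m) N k)

ψS≈ : ψS (-s (αS *s qS)) (-s qS) ≈s gaplessOddSeries
ψS≈ N k = begin
  ψS (-s (αS *s qS)) (-s qS) N k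
    ≡⟨ Σ≤≡Σ< (N ℕ.+ k) (λ m → ((-s qS) ^s (suc m ℕ.* suc m) *s inv (poch ψA ((-s qS) *s (-s qS)) (suc m))) N k) ⟩
  Σ< (suc (N ℕ.+ k)) (λ m → ((-s qS) ^s (suc m ℕ.* suc m) *s inv (poch ψA ((-s qS) *s (-s qS)) (suc m))) N k)
    ≡⟨ Σ<-cong (suc (N ℕ.+ k)) (λ m _ → Ψ.signed-quotient (suc m) N k) ⟨
  Σ< (suc (N ℕ.+ k)) (λ m → Ψ.signed (suc m) N k)
    ≡⟨ Σ<-pad (ℕ.m≤n⇒m≤1+n (ℕ.m≤m+n N k)) (λ m N≤m → trans (cong (_*_ (sgnℕ (suc m ℕ.+ k)))
         (shift-small (suc (m ℕ.* 2)) (λ M → C (m ℕ.+ k) m M + C (m ℕ.+ k) (suc m) M)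
           (s≤s (ℕ.≤-trans N≤m (ℕ.m≤m*n m 2)))))
         (ℤ.*-zeroʳ (sgnℕ (suc m ℕ.+ k)))) ⟩
  gaplessOddSeries N k ∎
  where open ≡-Reasoning

module GaplessOddChains = Chains odd? (ℕ._≟ 1) (λ x y → (y ℕ.≟ x ⊎-dec suc (suc y) ℕ.≟ x) ×-dec odd? y)

¬odd-suc : ∀ x → Odd x → ¬ Odd (suc x)
¬odd-suc (suc zero)    _ ()
¬odd-suc (suc (suc x)) p r = ¬odd-suc x p r

Gapless : ℕ → List ℕ → Set
Gapless x l = ∀ m → m ≤ x → Odd m → m ∈ l

-- For weakly decreasing odd parts, absence of gaps is local: each next part is equal or smaller by
-- 2, and the last part is 1.
InOC-cons : ∀ x l → InOC (suc x ∷ l) ⇔ (Odd (suc x) × GaplessOddChains.Accept (suc x) l)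
InOC-cons x l = mk⇔
  (λ { ((_ , _ , ls) , o ∷ os , g) → o , to (suc x) l o ls os (λ m m≤x → All.applyUpTo⁻ id (suc (suc x)) g (s≤s m≤x)) })
  from′
  where
  open GaplessOddChains

  bounded : ∀ {y l m} → Linked _≥_ (y ∷ l) → m ∈ y ∷ l → m ≤ y
  bounded ls       (here refl) = ℕ.≤-refl
  bounded (r ∷ ls) (there m∈l) = ℕ.≤-trans (bounded ls m∈l) r

  to : ∀ x l → Odd x → Linked _≥_ (x ∷ l) → All Odd l → Gapless x (x ∷ l) → Accept x l
  to x [] o [-] [] g with g 1 (odd⇒positive x o) refl
  ... | here 1≡x = sym 1≡x
  to x (y ∷ l) o (y≤x ∷ ls) (p ∷ ps) g with ℕ.m≤n⇒m<n∨m≡n y≤x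
  ... | inj₂ refl = (inj₁ refl , p) , to y l p ls ps gap
    where
    gap : Gapless y (y ∷ l)
    gap m m≤y om with g m m≤y om
    ... | here refl = here refl
    ... | there m∈l = m∈l
  ... | inj₁ y<x = (inj₂ 2+y≡x , p) , to y l p ls ps gap
    where
    gap : Gapless y (y ∷ l)
    gap m m≤y om with g m (ℕ.≤-trans m≤y y≤x) om
    ... | here refl = contradiction y<x (ℕ.≤⇒≯ m≤y)
    ... | there m∈l = m∈l

    2+y≤x : suc (suc y) ≤ x
    2+y≤x = ℕ.≤∧≢⇒< y<x (λ { refl → ¬odd-suc y p o })

    -- The odd number y + 2 has to occur, but every part after x is at most y, so x is the only
    -- place for it.
    2+y≡x : suc (suc y) ≡ x
    2+y≡x with g (suc (suc y)) 2+y≤x p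
    ... | here e    = e
    ... | there y∈l = contradiction (bounded ls y∈l) (ℕ.<⇒≱ (ℕ.m<n⇒m<1+n (ℕ.n<1+n y)))

  from : ∀ x l → Odd x → Accept x l → All (1 ≤_) l × Linked _≥_ (x ∷ l) × All Odd l × Gapless x (x ∷ l)
  from x [] o refl = [] , [-] , [] , λ { (suc zero) _ _ → here refl ; (suc (suc m)) (s≤s ()) _ }
  from x (y ∷ l) o ((s , p) , a) with ps , ls , os , g ← from y l p a =
    odd⇒positive y p ∷ ps , y≤x s ∷ ls , p ∷ os , gap s
    where
    y≤x : y ≡ x ⊎ suc (suc y) ≡ x → y ≤ x
    y≤x (inj₁ refl) = ℕ.≤-refl
    y≤x (inj₂ refl) = ℕ.m≤n⇒m≤1+n (ℕ.n≤1+n y)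

    gap : y ≡ x ⊎ suc (suc y) ≡ x → Gapless x (x ∷ y ∷ l)
    gap (inj₁ refl) m m≤x om = there (g m m≤x om)
    gap (inj₂ refl) m m≤x om with ℕ.m≤n⇒m<n∨m≡n m≤x
    ... | inj₂ refl = here refl
    ... | inj₁ (s≤s m≤1+y) with ℕ.m≤n⇒m<n∨m≡n m≤1+y
    ...   | inj₂ refl      = contradiction om (¬odd-suc y p)
    ...   | inj₁ (s≤s m≤y) = there (g m m≤y om)

  from′ : Odd (suc x) × Accept (suc x) l → InOC (suc x ∷ l)
  from′ (o , a) with ps , ls , os , g ← from (suc x) l o a =
    (tt , s≤s z≤n ∷ ps , ls) , o ∷ os , All.applyUpTo⁺₁ id (suc (suc x)) (λ m<2+x → g _ (ℕ.≤-pred m<2+x))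

if-⊎ : ∀ {A B : Set} (a? : Dec A) (b? : Dec B) → ¬ (A × B) → ∀ x →
  (if does (a? ⊎-dec b?) then x else + 0) ≡ (if does a? then x else + 0) + (if does b? then x else + 0)
if-⊎ (no _)  b?      ¬ab x = sym (ℤ.+-identityˡ _)
if-⊎ (yes _) (no _)  ¬ab x = sym (ℤ.+-identityʳ x)
if-⊎ (yes a) (yes b) ¬ab x = contradiction (a , b) ¬ab

-- After a part 2c + 1 the next part is 2c - 1 or 2c + 1, one summand for each. For c = 0 the first
-- summand is the empty continuation.
gaplessOdd-count : ∀ {b} n c N → suc (c ℕ.* 2) ≤ b → GaplessOddChains.count b n (suc (c ℕ.* 2)) N ≡ C n c N + C n (suc c) N
gaplessOdd-count zero zero    N c<b = cong (_+ + 0) (0≟≡δ₀ N)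
gaplessOdd-count zero (suc c) N c<b = refl
gaplessOdd-count {b} (suc n) zero N c<b = begin
  count b (suc n) 1 N
    ≡⟨ count-suc b n 1 N ⟩
  Σ< b (λ y → if does ((suc y ℕ.≟ 1 ⊎-dec suc (suc (suc y)) ℕ.≟ 1) ×-dec odd? (suc y)) then f y else + 0)
    ≡⟨ Σ<-cong b (λ y _ → cong (if_then f y else + 0)
         (does-⇔ (step⇔ y) ((suc y ℕ.≟ 1 ⊎-dec suc (suc (suc y)) ℕ.≟ 1) ×-dec odd? (suc y)) (y ℕ.≟ 0))) ⟩
  Σ< b (λ y → if does (y ℕ.≟ 0) then f y else + 0)
    ≡⟨ Σ<-single< b 0 f c<b ⟩
  shift 1 (count b n 1) N
    ≡⟨ shift-cong 1 (λ M → gaplessOdd-count n 0 M c<b) N ⟩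
  C (suc n) 1 N
    ≡⟨ ℤ.+-identityˡ (C (suc n) 1 N) ⟨
  C (suc n) 0 N + C (suc n) 1 N ∎
  where
  open ≡-Reasoning
  open GaplessOddChains
  f : ℕ → ℤ
  f y = shift (suc y) (count b n (suc y)) N

  step⇔ : ∀ y → ((suc y ≡ 1 ⊎ suc (suc (suc y)) ≡ 1) × Odd (suc y)) ⇔ (y ≡ 0)
  step⇔ y = mk⇔ (λ { (inj₁ refl , _) → refl ; (inj₂ () , _) }) (λ { refl → inj₁ refl , refl })
gaplessOdd-count {b} (suc n) (suc c) N c<b = begin
  count b (suc n) (suc (suc c ℕ.* 2)) N
    ≡⟨ count-suc b n (suc (suc c ℕ.* 2)) N ⟩
  Σ< b (λ y → if does (step y) then f y else + 0)
    ≡⟨ Σ<-cong b (λ y _ → split y) ⟩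
  Σ< b (λ y → (if does (y ℕ.≟ c ℕ.* 2) then f y else + 0) + (if does (y ℕ.≟ suc c ℕ.* 2) then f y else + 0))
    ≡⟨ Σ<-+ b (λ y → if does (y ℕ.≟ c ℕ.* 2) then f y else + 0) (λ y → if does (y ℕ.≟ suc c ℕ.* 2) then f y else + 0) ⟩
  Σ< b (λ y → if does (y ℕ.≟ c ℕ.* 2) then f y else + 0) + Σ< b (λ y → if does (y ℕ.≟ suc c ℕ.* 2) then f y else + 0)
    ≡⟨ cong₂ _+_ (Σ<-single< b (c ℕ.* 2) f c<b′) (Σ<-single< b (suc c ℕ.* 2) f c<b) ⟩
  f (c ℕ.* 2) + f (suc c ℕ.* 2)
    ≡⟨ cong₂ _+_ (shift-cong (suc (c ℕ.* 2)) (λ M → gaplessOdd-count n c M c<b′) N)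
                 (shift-cong (suc (suc c ℕ.* 2)) (λ M → gaplessOdd-count n (suc c) M c<b) N) ⟩
  C (suc n) (suc c) N + C (suc n) (suc (suc c)) N ∎
  where
  open ≡-Reasoning
  open GaplessOddChains
  f : ℕ → ℤ
  f y = shift (suc y) (count b n (suc y)) N

  c<b′ : suc (c ℕ.* 2) ≤ b
  c<b′ = ℕ.≤-trans (ℕ.m≤n⇒m≤1+n (ℕ.n≤1+n (suc (c ℕ.* 2)))) c<b

  step : ∀ y → Dec ((suc y ≡ suc (suc c ℕ.* 2) ⊎ suc (suc (suc y)) ≡ suc (suc c ℕ.* 2)) × Odd (suc y))
  step y = (suc y ℕ.≟ suc (suc c ℕ.* 2) ⊎-dec suc (suc (suc y)) ℕ.≟ suc (suc c ℕ.* 2)) ×-dec odd? (suc y)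

  step⇔ : ∀ y → ((suc y ≡ suc (suc c ℕ.* 2) ⊎ suc (suc (suc y)) ≡ suc (suc c ℕ.* 2)) × Odd (suc y))
                ⇔ (y ≡ c ℕ.* 2 ⊎ y ≡ suc c ℕ.* 2)
  step⇔ y = mk⇔ (λ { (inj₁ refl , _) → inj₂ refl ; (inj₂ refl , _) → inj₁ refl })
                (λ { (inj₁ refl) → inj₂ refl , double-odd c ; (inj₂ refl) → inj₁ refl , double-odd (suc c) })

  split : ∀ y → (if does (step y) then f y else + 0)
              ≡ (if does (y ℕ.≟ c ℕ.* 2) then f y else + 0) + (if does (y ℕ.≟ suc c ℕ.* 2) then f y else + 0)
  split y = trans (cong (if_then f y else + 0) (does-⇔ (step⇔ y) (step y) (y ℕ.≟ c ℕ.* 2 ⊎-dec y ℕ.≟ suc c ℕ.* 2))) 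
    (if-⊎ (y ℕ.≟ c ℕ.* 2) (y ℕ.≟ suc c ℕ.* 2) (λ { (refl , e) → contradiction e (ℕ.<⇒≢ (ℕ.m<n⇒m<1+n (ℕ.n<1+n (c ℕ.* 2)))) }) (f y))

-- The classes are indexed by largest part, so the double sum is interchanged first; largest part
-- and exponent of α then determine the number of parts.
genSer-OC : genSer inOC? (λ l → sgnℕ (length l)) (λ l → + length l - + half l) ≈s gaplessOddSeries
genSer-OC N k = begin
  genSer inOC? (λ l → sgnℕ (length l)) (λ l → + length l - + half l) N k
    ≡⟨ genSer-by-head inOC? (λ { ((() , _) , _) }) InOC-cons
         (λ x n → sgnℕ (suc n)) (λ x n → + suc n - + ((x ℕ.+ 1) ℕ./ 2))
         (λ l → sgnℕ (length l)) (λ l → + length l - + half l) (λ _ _ → refl) (λ _ _ → refl) N k ⟩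
  Σ< N (λ n → Σ< N (λ y → if does (odd? (suc y)) ∧ does (ex n y) then T n y else + 0))
    ≡⟨ Σ<-swap N N (λ n y → if does (odd? (suc y)) ∧ does (ex n y) then T n y else + 0) ⟩
  Σ< N (λ y → Σ< N (λ n → if does (odd? (suc y)) ∧ does (ex n y) then T n y else + 0))
    ≡⟨ Σ<-cong N (λ y _ → guard (does (odd? (suc y))) N (λ n → does (ex n y)) (λ n → T n y)) ⟩
  Σ< N g
    -- The range is padded to the even length 2N, with zero terms since those parts exceed N, so
    -- that `Σ<-odd` can select the odd ones.
    ≡⟨ Σ<-pad (ℕ.m≤m*n N 2) (λ y N≤y → large y N≤y) ⟨
  Σ< (N ℕ.* 2) g
    ≡⟨ Σ<-odd N (λ y → Σ< N (λ n → if does (ex n y) then T n y else + 0)) ⟩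
  Σ< N (λ m → Σ< N (λ n → if does (ex n (m ℕ.* 2)) then T n (m ℕ.* 2) else + 0))
    ≡⟨ Σ<-cong N (λ m _ → largestPart m) ⟩
  gaplessOddSeries N k ∎
  where
  open ≡-Reasoning
  open GaplessOddChains

  T : ℕ → ℕ → ℤ
  T n y = sgnℕ (suc n) * shift (suc y) (count N n (suc y)) N

  ex : ∀ n y → Dec (+ suc n - + ((suc y ℕ.+ 1) ℕ./ 2) ≡ + k)
  ex n y = + suc n - + ((suc y ℕ.+ 1) ℕ./ 2) ℤ.≟ + k

  g : ℕ → ℤ
  g y = if does (odd? (suc y)) then Σ< N (λ n → if does (ex n y) then T n y else + 0) else + 0

  guard : ∀ p n (r : ℕ → Bool) (f : ℕ → ℤ) →
    Σ< n (λ i → if p ∧ r i then f i else + 0) ≡ (if p then Σ< n (λ i → if r i then f i else + 0) else + 0)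
  guard true  n r f = refl
  guard false n r f = Σ<-zero n (λ _ _ → refl)

  if-zero : ∀ p {x : ℤ} → x ≡ + 0 → (if p then x else + 0) ≡ + 0
  if-zero true  e = e
  if-zero false e = refl

  large : ∀ y → N ≤ y → g y ≡ + 0
  large y N≤y = if-zero (does (odd? (suc y))) (Σ<-zero N (λ n _ → if-zero (does (ex n y))
    (trans (cong (_*_ (sgnℕ (suc n))) (shift-small (suc y) (count N n (suc y)) (s≤s N≤y))) (ℤ.*-zeroʳ (sgnℕ (suc n))))))

  shift-count : ∀ n m → shift (suc (m ℕ.* 2)) (count N n (suc (m ℕ.* 2))) N ≡ C (suc n) (suc m) N
  shift-count n m = shift-cong≤ (suc (m ℕ.* 2)) N (λ M mM≤N →
    gaplessOdd-count n m M (ℕ.≤-trans (ℕ.m≤m+n (suc (m ℕ.* 2)) M) mM≤N))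

  ex⇔ : ∀ n m → (+ suc n - + ((suc (m ℕ.* 2) ℕ.+ 1) ℕ./ 2) ≡ + k) ⇔ (n ≡ m ℕ.+ k)
  ex⇔ n m rewrite half-double m = mk⇔ (half-minus n m k) (λ { refl → minus-half m k })

  largestPart : ∀ m → Σ< N (λ n → if does (ex n (m ℕ.* 2)) then T n (m ℕ.* 2) else + 0) ≡ Ψ.signed (suc m) N k
  largestPart m = begin
    Σ< N (λ n → if does (ex n (m ℕ.* 2)) then T n (m ℕ.* 2) else + 0)
      ≡⟨ Σ<-cong N (λ n _ → cong (if_then T n (m ℕ.* 2) else + 0) (does-⇔ (ex⇔ n m) (ex n (m ℕ.* 2)) (n ℕ.≟ m ℕ.+ k))) ⟩
    Σ< N (λ n → if does (n ℕ.≟ m ℕ.+ k) then T n (m ℕ.* 2) else + 0)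
      -- An index outside the range is here a number of parts, so the term vanishes by `C-small`:
      -- more than N parts cannot sum to N.
      ≡⟨ Σ<-single N (m ℕ.+ k) (λ n → T n (m ℕ.* 2)) (λ N≤mk → trans
           (cong (_*_ (sgnℕ (suc (m ℕ.+ k)))) (trans (shift-count (m ℕ.+ k) m) (C-small (suc (m ℕ.+ k)) (suc m) (s≤s N≤mk))))
           (ℤ.*-zeroʳ (sgnℕ (suc (m ℕ.+ k))))) ⟩
    T (m ℕ.+ k) (m ℕ.* 2)
      ≡⟨ cong (_*_ (sgnℕ (suc (m ℕ.+ k)))) (shift-count (m ℕ.+ k) m) ⟩
    Ψ.signed (suc m) N k ∎

theorem5p1 : (fS (αS *s qS) qS ≈s 1s +s genSer inP? (λ l → sgn (rank l)) (λ l → + largest l))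
    × (φS (-s (αS *s qS)) (-s qS) ≈s 1s +s genSer inDO? (λ l → sgnℕ (half l)) (λ l → + half l - + length l))
    × (ψS (-s (αS *s qS)) (-s qS) ≈s genSer inOC? (λ l → sgnℕ (length l)) (λ l → + length l - + half l))
theorem5p1 =
    (λ N k → trans (fS≈ N k) (cong (_+_ (1s N k)) (sym (genSer-P N k))))
  , (λ N k → trans (φS≈ N k) (cong (_+_ (1s N k)) (sym (genSer-DO N k))))
  , (λ N k → trans (ψS≈ N k) (sym (genSer-OC N k)))
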